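{- For every even $n\ge4$, no vertex of the unweighted cycle $C_n$ is sedentary.
   Context: For a graph with adjacency matrix $A$, $U(t)=e^{itA}$. A vertex $u$ is sedentary if $\inf_{t>0}|U(t)_{u,u}|\ge C$ for some constant $0<C\le1$, and not sedentary if $\inf_{t>0}|U(t)_{u,u}|=0$. -}

module Defs where

open import Algebra.Bundles.Raw using (RawMonoid)
import Algebra.Definitions.RawMonoid as RawMonoidDefinitions
open import Data.Bool.Base using (if_then_else_)
open import Data.Fin.Base as Fin using (Fin; toℕ)
open import Data.Fin.Properties as Fin using ()
open import Data.Integer.Base using (+_)
open import Data.Nat.Base as ℕ using (ℕ; zero; suc; _!)
import Data.Nat.Properties as ℕ
open import Data.Product.Base using (∃-syntax; _×_; _,_; proj₁; proj₂)
open import Data.Rational.Base as ℚ using (ℚ; 0ℚ; 1ℚ; ½)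
import Data.Rational.Properties as ℚ
open import Data.Rational.Solver using (module +-*-Solver)
open import Data.Sum.Base using (_⊎_; inj₁; inj₂; swap)
open import Level using (0ℓ)
open import Relation.Binary.PropositionalEquality
open import Relation.Nullary using (¬_; Dec; does)
open import Relation.Nullary.Decidable using (_×-dec_; _⊎-dec_)

Eventually : (ℕ → Set) → Set
Eventually P = ∃[ N ] (∀ n → N ℕ.≤ n → P n)

IsCauchy : (ℕ → ℚ) → Set
IsCauchy f = ∀ ε → 0ℚ ℚ.< ε →
  ∃[ N ] (∀ m n → N ℕ.≤ m → N ℕ.≤ n → ℚ.∣ f m ℚ.- f n ∣ ℚ.< ε)

-- Cauchy sequences of rationals; the equality of real numbers is _≃_ below.
record ℝ : Set where
  constructor mkℝ
  field
    seq      : ℕ → ℚ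
    isCauchy : IsCauchy seq

open ℝ public

infix 4 _≃_ _<_ _≤_

_≃_ : ℝ → ℝ → Set
x ≃ y = ∀ ε → 0ℚ ℚ.< ε → Eventually λ n → ℚ.∣ seq x n ℚ.- seq y n ∣ ℚ.< ε

_<_ : ℝ → ℝ → Set
x < y = ∃[ δ ] (0ℚ ℚ.< δ × Eventually λ n → seq x n ℚ.+ δ ℚ.< seq y n)

_≤_ : ℝ → ℝ → Set
x ≤ y = ∀ ε → 0ℚ ℚ.< ε → Eventually λ n → seq x n ℚ.< seq y n ℚ.+ ε

module CauchyProperties where

  half+half : ∀ p → ½ ℚ.* p ℚ.+ ½ ℚ.* p ≡ p
  half+half p = trans (sym (ℚ.*-distribʳ-+ p ½ ½)) (ℚ.*-identityˡ p)

  half-pos : ∀ {p} → 0ℚ ℚ.< p → 0ℚ ℚ.< ½ ℚ.* p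
  half-pos {p} 0<p = subst (ℚ._< ½ ℚ.* p) (ℚ.*-zeroʳ ½) (ℚ.*-monoʳ-<-pos ½ 0<p)

  <-halves : ∀ {p q} ε → p ℚ.< ½ ℚ.* ε → q ℚ.< ½ ℚ.* ε → p ℚ.+ q ℚ.< ε
  <-halves ε p< q< = subst (_ ℚ.<_) (half+half ε) (ℚ.+-mono-< p< q<)

  eventually-bounded : ∀ f → IsCauchy f → ∃[ K ] (0ℚ ℚ.< K × Eventually λ n → ℚ.∣ f n ∣ ℚ.< K)
  eventually-bounded f fc with fc 1ℚ (ℚ.positive⁻¹ 1ℚ)
  ... | N , h = ℚ.∣ f N ∣ ℚ.+ 1ℚ , 0<K , N , below
    where
    0<K : 0ℚ ℚ.< ℚ.∣ f N ∣ ℚ.+ 1ℚ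
    0<K = ℚ.+-mono-≤-< (ℚ.0≤∣p∣ (f N)) (ℚ.positive⁻¹ 1ℚ)
    below : ∀ n → N ℕ.≤ n → ℚ.∣ f n ∣ ℚ.< ℚ.∣ f N ∣ ℚ.+ 1ℚ
    below n N≤n = begin-strict
      ℚ.∣ f n ∣                           ≡⟨ cong ℚ.∣_∣ (solve 2 (λ a b → a := b :+ (a :- b)) refl (f n) (f N)) ⟩
      ℚ.∣ f N ℚ.+ (f n ℚ.- f N) ∣         ≤⟨ ℚ.∣p+q∣≤∣p∣+∣q∣ (f N) (f n ℚ.- f N) ⟩
      ℚ.∣ f N ∣ ℚ.+ ℚ.∣ f n ℚ.- f N ∣     <⟨ ℚ.+-monoʳ-< ℚ.∣ f N ∣ (h n N N≤n ℕ.≤-refl) ⟩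
      ℚ.∣ f N ∣ ℚ.+ 1ℚ                    ∎
      where
      open ℚ.≤-Reasoning
      open +-*-Solver

  *-bound : ∀ {K} a b ε → 0ℚ ℚ.< K → (K≢0 : ℚ.NonZero K) →
            ℚ.∣ a ∣ ℚ.< K → ℚ.∣ b ∣ ℚ.< (ℚ.1/ K) {{K≢0}} ℚ.* ε → ℚ.∣ a ℚ.* b ∣ ℚ.< ε
  *-bound {K} a b ε 0<K K≢0 a<K b<ε/K = begin-strict
    ℚ.∣ a ℚ.* b ∣               ≡⟨ ℚ.∣p*q∣≡∣p∣*∣q∣ a b ⟩
    ℚ.∣ a ∣ ℚ.* ℚ.∣ b ∣         ≤⟨ ℚ.*-monoʳ-≤-nonNeg ℚ.∣ b ∣ {{ℚ.∣-∣-nonNeg b}} (ℚ.<⇒≤ a<K) ⟩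
    K ℚ.* ℚ.∣ b ∣               <⟨ ℚ.*-monoʳ-<-pos K {{ℚ.positive 0<K}} b<ε/K ⟩
    K ℚ.* (ℚ.1/ K ℚ.* ε)        ≡⟨ ℚ.*-assoc K (ℚ.1/ K) ε ⟨
    K ℚ.* ℚ.1/ K ℚ.* ε          ≡⟨ cong (ℚ._* ε) (ℚ.*-inverseʳ K) ⟩
    1ℚ ℚ.* ε                    ≡⟨ ℚ.*-identityˡ ε ⟩
    ε                           ∎
    where
    open ℚ.≤-Reasoning
    instance _ = K≢0

  1/-*-pos : ∀ {K ε} → 0ℚ ℚ.< K → (K≢0 : ℚ.NonZero K) → 0ℚ ℚ.< ε →
             0ℚ ℚ.< (ℚ.1/ K) {{K≢0}} ℚ.* ε
  1/-*-pos {K} {ε} 0<K K≢0 0<ε =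
    subst (ℚ._< (ℚ.1/ K) {{K≢0}} ℚ.* ε) (ℚ.*-zeroʳ ((ℚ.1/ K) {{K≢0}}))
      (ℚ.*-monoʳ-<-pos ((ℚ.1/ K) {{K≢0}}) {{ℚ.1/pos⇒pos K {{ℚ.positive 0<K}}}} 0<ε)

  const-cauchy : ∀ q → IsCauchy (λ _ → q)
  const-cauchy q ε 0<ε = 0 , λ _ _ _ _ →
    subst (λ p → ℚ.∣ p ∣ ℚ.< ε) (sym (ℚ.+-inverseʳ q)) 0<ε

  +-cauchy : ∀ f g → IsCauchy f → IsCauchy g → IsCauchy (λ n → f n ℚ.+ g n)
  +-cauchy f g fc gc ε 0<ε
    with fc (½ ℚ.* ε) (half-pos 0<ε) | gc (½ ℚ.* ε) (half-pos 0<ε)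
  ... | M , hf | N , hg = M ℕ.⊔ N , λ m n ≤m ≤n → begin-strict
      ℚ.∣ (f m ℚ.+ g m) ℚ.- (f n ℚ.+ g n) ∣
        ≡⟨ cong ℚ.∣_∣ (solve 4 (λ a b c d → (a :+ b) :- (c :+ d) := (a :- c) :+ (b :- d)) refl (f m) (g m) (f n) (g n)) ⟩
      ℚ.∣ (f m ℚ.- f n) ℚ.+ (g m ℚ.- g n) ∣
        ≤⟨ ℚ.∣p+q∣≤∣p∣+∣q∣ (f m ℚ.- f n) (g m ℚ.- g n) ⟩
      ℚ.∣ f m ℚ.- f n ∣ ℚ.+ ℚ.∣ g m ℚ.- g n ∣
        <⟨ <-halves ε (hf m n (ℕ.m⊔n≤o⇒m≤o M N ≤m) (ℕ.m⊔n≤o⇒m≤o M N ≤n))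
                      (hg m n (ℕ.m⊔n≤o⇒n≤o M N ≤m) (ℕ.m⊔n≤o⇒n≤o M N ≤n)) ⟩
      ε ∎
    where
    open ℚ.≤-Reasoning
    open +-*-Solver

  -‿cauchy : ∀ f → IsCauchy f → IsCauchy (λ n → ℚ.- f n)
  -‿cauchy f fc ε 0<ε with fc ε 0<ε
  ... | N , h = N , λ m n ≤m ≤n →
    subst (ℚ._< ε)
      (cong ℚ.∣_∣ (solve 2 (λ a b → b :- a := (:- a) :- (:- b)) refl (f m) (f n)))
      (h n m ≤n ≤m)
    where open +-*-Solver

  *-cauchy : ∀ f g → IsCauchy f → IsCauchy g → IsCauchy (λ n → f n ℚ.* g n)
  *-cauchy f g fc gc ε 0<ε = go (eventually-bounded f fc) (eventually-bounded g gc)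
    where
    open ℚ.≤-Reasoning
    open +-*-Solver
    go : ∃[ K ] (0ℚ ℚ.< K × Eventually λ n → ℚ.∣ f n ∣ ℚ.< K) →
         ∃[ L ] (0ℚ ℚ.< L × Eventually λ n → ℚ.∣ g n ∣ ℚ.< L) →
         ∃[ N ] (∀ m n → N ℕ.≤ m → N ℕ.≤ n → ℚ.∣ f m ℚ.* g m ℚ.- f n ℚ.* g n ∣ ℚ.< ε)
    go (K , 0<K , N₁ , f<K) (L , 0<L , N₂ , g<L) = go′ (gc (ℚ.1/ K ℚ.* (½ ℚ.* ε)) (1/-*-pos 0<K K≢0 (half-pos 0<ε)))
                                                     (fc (ℚ.1/ L ℚ.* (½ ℚ.* ε)) (1/-*-pos 0<L L≢0 (half-pos 0<ε)))
      where
      K≢0 = ℚ.pos⇒nonZero K {{ℚ.positive 0<K}}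
      L≢0 = ℚ.pos⇒nonZero L {{ℚ.positive 0<L}}
      instance
        _ = K≢0
        _ = L≢0
      go′ : ∃[ N ] (∀ m n → N ℕ.≤ m → N ℕ.≤ n → ℚ.∣ g m ℚ.- g n ∣ ℚ.< ℚ.1/ K ℚ.* (½ ℚ.* ε)) →
            ∃[ N ] (∀ m n → N ℕ.≤ m → N ℕ.≤ n → ℚ.∣ f m ℚ.- f n ∣ ℚ.< ℚ.1/ L ℚ.* (½ ℚ.* ε)) →
            ∃[ N ] (∀ m n → N ℕ.≤ m → N ℕ.≤ n → ℚ.∣ f m ℚ.* g m ℚ.- f n ℚ.* g n ∣ ℚ.< ε)
      go′ (N₃ , hg) (N₄ , hf) = (N₁ ℕ.⊔ N₂) ℕ.⊔ (N₃ ℕ.⊔ N₄) , λ m n ≤m ≤n →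
        let m₁₂ = ℕ.m⊔n≤o⇒m≤o (N₁ ℕ.⊔ N₂) (N₃ ℕ.⊔ N₄) ≤m
            m₃₄ = ℕ.m⊔n≤o⇒n≤o (N₁ ℕ.⊔ N₂) (N₃ ℕ.⊔ N₄) ≤m
            n₁₂ = ℕ.m⊔n≤o⇒m≤o (N₁ ℕ.⊔ N₂) (N₃ ℕ.⊔ N₄) ≤n
            n₃₄ = ℕ.m⊔n≤o⇒n≤o (N₁ ℕ.⊔ N₂) (N₃ ℕ.⊔ N₄) ≤n
        in begin-strict
          ℚ.∣ f m ℚ.* g m ℚ.- f n ℚ.* g n ∣
            ≡⟨ cong ℚ.∣_∣ (solve 4 (λ a b c d → a :* b :- c :* d := a :* (b :- d) :+ d :* (a :- c)) refl (f m) (g m) (f n) (g n)) ⟩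
          ℚ.∣ f m ℚ.* (g m ℚ.- g n) ℚ.+ g n ℚ.* (f m ℚ.- f n) ∣
            ≤⟨ ℚ.∣p+q∣≤∣p∣+∣q∣ (f m ℚ.* (g m ℚ.- g n)) (g n ℚ.* (f m ℚ.- f n)) ⟩
          ℚ.∣ f m ℚ.* (g m ℚ.- g n) ∣ ℚ.+ ℚ.∣ g n ℚ.* (f m ℚ.- f n) ∣
            <⟨ <-halves ε
                 (*-bound (f m) (g m ℚ.- g n) (½ ℚ.* ε) 0<K K≢0 (f<K m (ℕ.m⊔n≤o⇒m≤o N₁ N₂ m₁₂))
                   (hg m n (ℕ.m⊔n≤o⇒m≤o N₃ N₄ m₃₄) (ℕ.m⊔n≤o⇒m≤o N₃ N₄ n₃₄)))
                 (*-bound (g n) (f m ℚ.- f n) (½ ℚ.* ε) 0<L L≢0 (g<L n (ℕ.m⊔n≤o⇒n≤o N₁ N₂ n₁₂))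
                   (hf m n (ℕ.m⊔n≤o⇒n≤o N₃ N₄ m₃₄) (ℕ.m⊔n≤o⇒n≤o N₃ N₄ n₃₄))) ⟩
          ε ∎

  ||-cauchy : ∀ f → IsCauchy f → IsCauchy (λ n → ℚ.∣ f n ∣)
  ||-cauchy f fc ε 0<ε with fc ε 0<ε
  ... | N , h = N , λ m n ≤m ≤n → abs-< {ℚ.∣ f m ∣} {ℚ.∣ f n ∣} (ℚ.∣p∣≡p∨∣p∣≡-p (ℚ.∣ f m ∣ ℚ.- ℚ.∣ f n ∣))
                  (ℚ.≤-<-trans (reverse (f m) (f n)) (h m n ≤m ≤n))
                  (ℚ.≤-<-trans (reverse (f n) (f m)) (h n m ≤n ≤m))
    where
    open +-*-Solver
    reverse : ∀ a b → ℚ.∣ a ∣ ℚ.- ℚ.∣ b ∣ ℚ.≤ ℚ.∣ a ℚ.- b ∣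
    reverse a b = begin
      ℚ.∣ a ∣ ℚ.- ℚ.∣ b ∣
        ≡⟨ cong (λ c → ℚ.∣ c ∣ ℚ.- ℚ.∣ b ∣) (solve 2 (λ a b → a := (a :- b) :+ b) refl a b) ⟩
      ℚ.∣ (a ℚ.- b) ℚ.+ b ∣ ℚ.- ℚ.∣ b ∣
        ≤⟨ ℚ.+-monoˡ-≤ (ℚ.- ℚ.∣ b ∣) (ℚ.∣p+q∣≤∣p∣+∣q∣ (a ℚ.- b) b) ⟩
      ℚ.∣ a ℚ.- b ∣ ℚ.+ ℚ.∣ b ∣ ℚ.- ℚ.∣ b ∣
        ≡⟨ solve 2 (λ c d → c :+ d :- d := c) refl ℚ.∣ a ℚ.- b ∣ ℚ.∣ b ∣ ⟩
      ℚ.∣ a ℚ.- b ∣ ∎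
      where open ℚ.≤-Reasoning
    abs-< : ∀ {a b} → ℚ.∣ a ℚ.- b ∣ ≡ a ℚ.- b ⊎ ℚ.∣ a ℚ.- b ∣ ≡ ℚ.- (a ℚ.- b) →
            a ℚ.- b ℚ.< ε → b ℚ.- a ℚ.< ε → ℚ.∣ a ℚ.- b ∣ ℚ.< ε
    abs-<         (inj₁ e) a<b b<a = subst (ℚ._< ε) (sym e) a<b
    abs-< {a} {b} (inj₂ e) a<b b<a = subst (ℚ._< ε)
      (trans (solve 2 (λ a b → b :- a := :- (a :- b)) refl a b) (sym e)) b<a

open CauchyProperties

-- Abstract, so that normalising a real number does not unfold these proofs.
abstract
  const-isCauchy : ∀ q → IsCauchy (λ _ → q)
  const-isCauchy = const-cauchy

  +-isCauchy : ∀ x y → IsCauchy (λ n → seq x n ℚ.+ seq y n)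
  +-isCauchy x y = +-cauchy (seq x) (seq y) (isCauchy x) (isCauchy y)

  -‿isCauchy : ∀ x → IsCauchy (λ n → ℚ.- seq x n)
  -‿isCauchy x = -‿cauchy (seq x) (isCauchy x)

  *-isCauchy : ∀ x y → IsCauchy (λ n → seq x n ℚ.* seq y n)
  *-isCauchy x y = *-cauchy (seq x) (seq y) (isCauchy x) (isCauchy y)

  ∣∣-isCauchy : ∀ x → IsCauchy (λ n → ℚ.∣ seq x n ∣)
  ∣∣-isCauchy x = ||-cauchy (seq x) (isCauchy x)

infixl 6 _+_ _-_
infixl 7 _*_
infix  8 -_

fromℚ : ℚ → ℝ
fromℚ q = mkℝ (λ _ → q) (const-isCauchy q)

0ℝ 1ℝ : ℝ
0ℝ = fromℚ 0ℚ
1ℝ = fromℚ 1ℚ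

-_ : ℝ → ℝ
- x = mkℝ (λ n → ℚ.- seq x n) (-‿isCauchy x)

_+_ _*_ _-_ : ℝ → ℝ → ℝ
x + y = mkℝ (λ n → seq x n ℚ.+ seq y n) (+-isCauchy x y)
x * y = mkℝ (λ n → seq x n ℚ.* seq y n) (*-isCauchy x y)
x - y = x + (- y)

∣_∣ : ℝ → ℝ
∣ x ∣ = mkℝ (λ n → ℚ.∣ seq x n ∣) (∣∣-isCauchy x)

<0+⇒≱ : ∀ x y → x < 0ℝ + y → ¬ (y ≤ x)
<0+⇒≱ x y (δ , 0<δ , M , x<y) y≤x =
  let N , y<x = y≤x δ 0<δ
      k       = M ℕ.⊔ N
  in ℚ.<-asym (y<x k (ℕ.m≤n⊔m M N))
       (subst (seq x k ℚ.+ δ ℚ.<_) (ℚ.+-identityˡ (seq y k)) (x<y k (ℕ.m≤m⊔n M N)))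

-- In the constructive sense: x is a lower bound of S that is approximated
-- arbitrarily closely by elements of S.  This implies that x is the greatest
-- lower bound, and is classically equivalent to it.
IsInfimum : (ℝ → Set) → ℝ → Set
IsInfimum S x =
  (∀ r → S r → x ≤ r) ×
  (∀ ε → 0ℝ < ε → ∃[ r ] (S r × r < x + ε))

ConvergesTo : (ℕ → ℝ) → ℝ → Set
ConvergesTo s x = ∀ ε → 0ℝ < ε → Eventually λ n → ∣ s n - x ∣ < ε

record ℂ : Set where
  constructor _+i_
  field
    re : ℝ
    im : ℝ

open ℂ public

infixl 6 _+ᶜ_
infixl 7 _*ᶜ_

0ᶜ 1ᶜ : ℂ
0ᶜ = 0ℝ +i 0ℝ
1ᶜ = 1ℝ +i 0ℝ

_+ᶜ_ _*ᶜ_ : ℂ → ℂ → ℂ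
z +ᶜ w = (re z + re w) +i (im z + im w)
z *ᶜ w = (re z * re w - im z * im w) +i (re z * im w + im z * re w)

_≃ᶜ_ : ℂ → ℂ → Set
z ≃ᶜ w = re z ≃ re w × im z ≃ im w

-- r = |z|, with |z| the nonnegative square root of (re z)² + (im z)².
IsModulus : ℂ → ℝ → Set
IsModulus z r = 0ℝ ≤ r × r * r ≃ re z * re z + im z * im z

ConvergesToᶜ : (ℕ → ℂ) → ℂ → Set
ConvergesToᶜ s z =
  ConvergesTo (λ n → re (s n)) (re z) × ConvergesTo (λ n → im (s n)) (im z)

+ᶜ-rawMonoid : RawMonoid 0ℓ 0ℓ
+ᶜ-rawMonoid = record { Carrier = ℂ ; _≈_ = _≃ᶜ_ ; _∙_ = _+ᶜ_ ; ε = 0ᶜ }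

open RawMonoidDefinitions +ᶜ-rawMonoid using (sum)

Matrix : ℕ → Set
Matrix n = Fin n → Fin n → ℂ

module _ {n : ℕ} where

  identity : Matrix n
  identity i j = if does (i Fin.≟ j) then 1ᶜ else 0ᶜ

  infixl 7 _⊗_
  _⊗_ : Matrix n → Matrix n → Matrix n
  (M ⊗ N) i j = sum (λ k → M i k *ᶜ N k j)

  infixr 8 _^_
  _^_ : Matrix n → ℕ → Matrix n
  M ^ zero  = identity
  M ^ suc k = M ⊗ M ^ k

  infixr 7 _•_
  _•_ : ℂ → Matrix n → Matrix n
  (c • M) i j = c *ᶜ M i j

  1/_! : ℕ → ℂ
  1/ k ! = fromℚ ((+ 1 ℚ./ k !) {{k ℕ.!≢0}}) +i 0ℝ

  -- ∑ M^k / k! over k < N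
  expSum : Matrix n → ℕ → Matrix n
  expSum M zero    i j = 0ᶜ
  expSum M (suc N) i j = expSum M N i j +ᶜ (1/ N ! • M ^ N) i j

  -- E = e^M
  IsExp : Matrix n → Matrix n → Set
  IsExp M E = ∀ i j → ConvergesToᶜ (λ N → expSum M N i j) (E i j)

record SimpleGraph (n : ℕ) : Set₁ where
  infix 4 _~_ _~?_
  field
    _~_    : Fin n → Fin n → Set
    _~?_   : ∀ u v → Dec (u ~ v)
    sym-~  : ∀ {u v} → u ~ v → v ~ u
    irrefl : ∀ {u} → ¬ (u ~ u)

adjacency : ∀ {n} → SimpleGraph n → Matrix n
adjacency G u v = if does (u ~? v) then 1ᶜ else 0ᶜ
  where open SimpleGraph G

-- v = u + 1 modulo n
Next : ∀ {n} → Fin n → Fin n → Set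
Next {n} u v = suc (toℕ u) ≡ toℕ v ⊎ (suc (toℕ u) ≡ n × toℕ v ≡ 0)

next? : ∀ {n} (u v : Fin n) → Dec (Next u v)
next? {n} u v =
  (suc (toℕ u) ℕ.≟ toℕ v) ⊎-dec ((suc (toℕ u) ℕ.≟ n) ×-dec (toℕ v ℕ.≟ 0))

next-irrefl : ∀ {n} → 3 ℕ.≤ n → ∀ {u : Fin n} → ¬ Next u u
next-irrefl 3≤n (inj₁ e) = ℕ.1+n≢n e
next-irrefl 3≤n (inj₂ (e , e′))
  with ℕ.s≤s () ← subst (3 ℕ.≤_) (trans (sym e) (cong suc e′)) 3≤n

cycle : ∀ n → 3 ℕ.≤ n → SimpleGraph n
cycle n 3≤n = record
  { _~_    = λ u v → Next u v ⊎ Next v u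
  ; _~?_   = λ u v → next? u v ⊎-dec next? v u
  ; sym-~  = swap
  ; irrefl = λ { (inj₁ h) → next-irrefl 3≤n h ; (inj₂ h) → next-irrefl 3≤n h }
  }

-- U = U(t) = e^{itA}
IsTransitionMatrix : ∀ {n} → SimpleGraph n → ℝ → Matrix n → Set
IsTransitionMatrix G t U = IsExp ((0ℝ +i t) • adjacency G) U

-- The set of the values |U(t)ᵤᵤ| for t > 0.
ReturnModuli : ∀ {n} → SimpleGraph n → Fin n → ℝ → Set
ReturnModuli G u r =
  ∃[ t ] (0ℝ < t × ∃[ U ] (IsTransitionMatrix G t U × IsModulus (U u u) r))

Sedentary : ∀ {n} → SimpleGraph n → Fin n → Set
Sedentary G u =
  ∃[ C ] (0ℝ < C × C ≤ 1ℝ × (∀ r → ReturnModuli G u r → C ≤ r))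

NotSedentary : ∀ {n} → SimpleGraph n → Fin n → Set
NotSedentary G u = IsInfimum (ReturnModuli G u) 0ℝ

notSedentary⇒¬sedentary : ∀ {n} (G : SimpleGraph n) u → NotSedentary G u → ¬ Sedentary G u
notSedentary⇒¬sedentary G u (_ , approx) (C , 0<C , _ , C≤) =
  let r , r∈ , r<0+C = approx C 0<C in <0+⇒≱ r C r<0+C (C≤ r r∈)

module Submission where

-- The diagonal entry is U(t)ᵤᵤ = Σ (it)ᵏ wₖ / k!, where wₖ counts the closed walks of length k at u.
-- For even n the odd wₖ vanish, so f(t) = U(t)ᵤᵤ is real, with f(0) = 1, and it suffices to approximate
-- a root of f.  For n > 4, w₂ ≥ 2, w₄ = 6, w₆ ≥ 20 and wₖ ≤ 2ᵏ give f(3/2) < 0.  For n = 4, f never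
-- becomes negative: w₂ₖ = 2²ᵏ⁻¹ for k > 0, hence f(t) = cos² t, and one approximates a root of cos instead.
-- In both cases the root is found by bisection, for a partial sum of the series and with rational t, where
-- signs are decidable; the remaining terms are bounded by a geometric series.

open import Algebra.Bundles using (CommutativeRing)
import Algebra.Definitions.RawMonoid
open import Data.Bool.Base using (if_then_else_)
open import Data.Fin.Base as Fin using (Fin; zero; suc; toℕ; fromℕ<)
import Data.Fin.Properties as Fin
open import Data.Integer.Base as ℤ using (+_)
import Data.Integer.Properties as ℤ
open import Data.Nat.Base as ℕ using (ℕ; zero; suc; _!; s≤s) renaming (_≤_ to _≤ℕ_)
import Data.Nat.Coprimality as Coprimality
open import Data.Nat.DivMod using (_%_; m%n<n; m<n⇒m%n≡m; n%n≡0; [m+kn]%n≡m%n; m≡m%n+[m/n]*n)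
open import Data.Nat.Divisibility using (_∣_; _∤_; divides; ∣-trans; ∣-refl; ∣⇒≤; ∣m+n∣m⇒∣n; ∣m∣n⇒∣m+n; m∣m*n; n∣m*n; _∣?_; _∣0)
import Data.Nat.Properties as ℕ
open import Data.Product.Base using (∃-syntax; _×_; _,_)
import Data.Rational.Base as ℚ
import Data.Rational.Properties as ℚ
open import Data.Rational.Solver using (module +-*-Solver)
open import Data.Rational.Unnormalised.Base as ℚᵘ using (mkℚᵘ; *≡*)
import Data.Rational.Unnormalised.Properties as ℚᵘ
open import Data.Sum.Base using (_⊎_; inj₁; inj₂)
open import Function.Base using (_∘_)
open import Relation.Binary.PropositionalEquality
open import Relation.Nullary using (Dec; yes; no; does; ¬_; contradiction)
open import Algebra.Definitions.RawSemiring ℚ.+-*-rawSemiring using () renaming (_^_ to _^ℚ_)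
open import Algebra.Properties.CommutativeSemiring.Exp (CommutativeRing.commutativeSemiring ℚ.+-*-commutativeRing) using (^-distrib-*)
open import Algebra.Properties.Semiring.Sum (CommutativeRing.semiring ℚ.+-*-commutativeRing) using (sum; sum-cong-≗; sum-replicate-zero; ∑-distrib-+; *-distribˡ-sum)
open +-*-Solver

-- The infimum condition asks only for values below each ε, so no real root is ever constructed: a
-- rational t with |f(t)| small suffices. For rational t the entries of the powers of itA are
-- constant sequences, so everything reduces to rational partial sums, and U(t) can be the matrix of
-- reals whose n-th approximations are the n-th partial sums. All t used satisfy t ≤ 2, which makes
-- the tail bounds uniform in t.
--
-- The point 3/2 comes from the infinite path, where the closed walk counts are the central binomial
-- coefficients 1, 2, 6, 20 and f(t) = J₀(2t). Its first zero is near 1.2, and J₀(3) is about -0.26,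
-- which leaves room for crude tails. Cycles differ only by walks that wind around. The terms at 3/2
-- are negative for k = 2, 6 and positive for k = 4, 8, so w₂ and w₆ are bounded from below, w₄ and
-- w₈ from above, and one point serves all even n > 4.
--
-- For n = 4 the identity f = cos² must be usable on partial sums. It is therefore proved
-- coefficient by coefficient for the Cauchy product, and the square of a partial sum is compared
-- with the partial sum of that product.

module RationalSeries where

  open import Data.Rational.Base
  open import Data.Rational.Properties

  -- Order and absolute value of rationals

  ≤-from-difference : ∀ {p q r} → q - p ≡ r → 0ℚ ≤ r → p ≤ q
  ≤-from-difference {p} {q} refl 0≤q-p =
    subst₂ _≤_ (+-identityˡ p) (solve 2 (λ p q → q :- p :+ p := q) refl p q)
      (+-monoˡ-≤ p 0≤q-p)

  +-nonNeg : ∀ {p q} → 0ℚ ≤ p → 0ℚ ≤ q → 0ℚ ≤ p + q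
  +-nonNeg = +-mono-≤

  *-nonNeg : ∀ {p q} → 0ℚ ≤ p → 0ℚ ≤ q → 0ℚ ≤ p * q
  *-nonNeg {p} {q} 0≤p 0≤q =
    nonNegative⁻¹ (p * q) {{nonNeg*nonNeg⇒nonNeg p {{nonNegative 0≤p}} q {{nonNegative 0≤q}}}}

  *-mono-≤ : ∀ {p q r s} → 0ℚ ≤ q → 0ℚ ≤ r → p ≤ q → r ≤ s → p * r ≤ q * s
  *-mono-≤ {p} {q} {r} {s} 0≤q 0≤r p≤q r≤s = ≤-trans
    (*-monoʳ-≤-nonNeg r {{nonNegative 0≤r}} p≤q)
    (*-monoˡ-≤-nonNeg q {{nonNegative 0≤q}} r≤s)

  *-monoʳ-≤ : ∀ {p q r} → 0ℚ ≤ p → q ≤ r → p * q ≤ p * r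
  *-monoʳ-≤ {p} 0≤p = *-monoˡ-≤-nonNeg p {{nonNegative 0≤p}}

  *-monoˡ-≤ : ∀ {p q r} → 0ℚ ≤ r → p ≤ q → p * r ≤ q * r
  *-monoˡ-≤ {r = r} 0≤r = *-monoʳ-≤-nonNeg r {{nonNegative 0≤r}}

  ∣∣-*-mono : ∀ {p q b c} → ∣ p ∣ ≤ b → ∣ q ∣ ≤ c → ∣ p * q ∣ ≤ b * c
  ∣∣-*-mono {p} {q} ∣p∣≤b ∣q∣≤c = subst (_≤ _) (sym (∣p*q∣≡∣p∣*∣q∣ p q))
    (*-mono-≤ (≤-trans (0≤∣p∣ p) ∣p∣≤b) (0≤∣p∣ q) ∣p∣≤b ∣q∣≤c)

  ∣∣-+-mono : ∀ {p q b c} → ∣ p ∣ ≤ b → ∣ q ∣ ≤ c → ∣ p + q ∣ ≤ b + c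
  ∣∣-+-mono {p} {q} ∣p∣≤b ∣q∣≤c = ≤-trans (∣p+q∣≤∣p∣+∣q∣ p q) (+-mono-≤ ∣p∣≤b ∣q∣≤c)

  p≤∣p∣ : ∀ p → p ≤ ∣ p ∣
  p≤∣p∣ p with ∣p∣≡p∨∣p∣≡-p p
  ... | inj₁ e = ≤-reflexive (sym e)
  ... | inj₂ e = ≤-from-difference {r = ∣ p ∣ + ∣ p ∣}
    (subst (λ q → q - p ≡ q + q) (sym e) refl) (+-nonNeg (0≤∣p∣ p) (0≤∣p∣ p))

  ∣p-q∣≡∣q-p∣ : ∀ p q → ∣ p - q ∣ ≡ ∣ q - p ∣
  ∣p-q∣≡∣q-p∣ p q = trans (cong ∣_∣ (solve 2 (λ p q → p :- q := :- (q :- p)) refl p q)) (∣-p∣≡∣p∣ (q - p))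

  ^-nonNeg : ∀ {p} → 0ℚ ≤ p → ∀ k → 0ℚ ≤ p ^ℚ k
  ^-nonNeg 0≤p zero    = nonNegative⁻¹ 1ℚ
  ^-nonNeg 0≤p (suc k) = *-nonNeg 0≤p (^-nonNeg 0≤p k)

  0≤½ : 0ℚ ≤ ½
  0≤½ = nonNegative⁻¹ ½

  -- Numerals and inverse factorials

  2ℚ 3ℚ 4ℚ 6ℚ 15ℚ 20ℚ : ℚ
  2ℚ = + 2 / 1
  3ℚ = + 3 / 1
  4ℚ = + 4 / 1
  6ℚ = + 6 / 1
  15ℚ = + 15 / 1
  20ℚ = + 20 / 1

  -- Built with `mkℚ` rather than `/`, so that numerator and denominator compute for a variable n
  -- instead of being stuck on a gcd.
  fromℕ : ℕ → ℚ
  fromℕ n = mkℚ (+ n) 0 (Coprimality.sym (Coprimality.1-coprimeTo n))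

  fromℕ-suc : ∀ n → fromℕ (suc n) ≡ 1ℚ + fromℕ n
  fromℕ-suc n = toℚᵘ-injective (ℚᵘ.≃-trans (*≡* lemma) (ℚᵘ.≃-sym (toℚᵘ-homo-+ 1ℚ (fromℕ n))))
    where
    lemma : + suc n ℤ.* + 1 ≡ (+ 1 ℤ.* + 1 ℤ.+ + n ℤ.* + 1) ℤ.* + 1
    lemma = cong (λ m → (+ 1 ℤ.+ m) ℤ.* + 1) (sym (ℤ.*-identityʳ (+ n)))

  fromℕ-nonNeg : ∀ n → 0ℚ ≤ fromℕ n
  fromℕ-nonNeg n = nonNegative⁻¹ (fromℕ n)

  1≤fromℕ-suc : ∀ n → 1ℚ ≤ fromℕ (suc n)
  1≤fromℕ-suc n = ≤-from-difference {r = fromℕ n}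
    (trans (cong (_- 1ℚ) (fromℕ-suc n)) (solve 1 (λ m → con 1ℚ :+ m :- con 1ℚ := m) refl (fromℕ n)))
    (fromℕ-nonNeg n)

  fromℕ-mono : ∀ {m n} → m ℕ.≤ n → fromℕ m ≤ fromℕ n
  fromℕ-mono m≤n = *≤* (ℤ.*-monoʳ-≤-nonNeg (+ 1) (ℤ.+≤+ m≤n))

  -- Denominators are at least 1. This serves as a ceiling function when an index has to be chosen
  -- from a rational.
  p≤fromℕ : ∀ p → p ≤ fromℕ ℤ.∣ ↥ p ∣
  p≤fromℕ p@(mkℚ (+ n) d _) = *≤* (ℤ.*-monoˡ-≤-nonNeg (+ n) (ℤ.+≤+ (ℕ.s≤s ℕ.z≤n)))
  p≤fromℕ p@(mkℚ (ℤ.-[1+ n ]) d _) = *≤* (ℤ.≤-trans ℤ.-≤+ (ℤ.≤-reflexive (sym (ℤ.pos-* (suc n) (suc d)))))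

  1/!_ : ℕ → ℚ
  1/! k = (+ 1 / k !) {{k ℕ.!≢0}}

  toℚᵘ-/ : ∀ i n .{{_ : ℕ.NonZero n}} → toℚᵘ (i / n) ℚᵘ.≃ (i ℚᵘ./ n)
  toℚᵘ-/ i (suc n) = toℚᵘ-fromℚᵘ (mkℚᵘ i n)

  fromℕ-*-1/! : ∀ k → fromℕ (suc k) * 1/! (suc k) ≡ 1/! k
  fromℕ-*-1/! k = toℚᵘ-injective (begin
    toℚᵘ (fromℕ (suc k) * 1/! (suc k))               ≈⟨ toℚᵘ-homo-* (fromℕ (suc k)) (1/! (suc k)) ⟩
    mkℚᵘ (+ suc k) 0 ℚᵘ.* toℚᵘ (1/! (suc k))         ≈⟨ ℚᵘ.*-congˡ {mkℚᵘ (+ suc k) 0} (toℚᵘ-/ (+ 1) (suc k !)) ⟩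
    mkℚᵘ (+ suc k) 0 ℚᵘ.* (+ 1 ℚᵘ./ suc k !)         ≈⟨ cancel k (k !) ⟩
    + 1 ℚᵘ./ k !                                     ≈⟨ toℚᵘ-/ (+ 1) (k !) ⟨
    toℚᵘ (1/! k)                                     ∎)
    where
    open ℚᵘ.≃-Reasoning
    instance
      _ = k ℕ.!≢0
      _ = suc k ℕ.!≢0
    cancel : ∀ k m .{{_ : ℕ.NonZero m}} .{{_ : ℕ.NonZero (suc k ℕ.* m)}} →
             mkℚᵘ (+ suc k) 0 ℚᵘ.* (+ 1 ℚᵘ./ (suc k ℕ.* m)) ℚᵘ.≃ (+ 1 ℚᵘ./ m)
    cancel k m@(suc _) = *≡* (cong +_ (trans (cong (ℕ._* m) (ℕ.*-identityʳ (suc k))) (sym (trans (ℕ.+-identityʳ _) (ℕ.+-identityʳ _)))))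

  1/!-nonNeg : ∀ k → 0ℚ ≤ 1/! k
  1/!-nonNeg k = nonNegative⁻¹ (1/! k) {{normalize-nonNeg 1 (k !) {{k ℕ.!≢0}}}}

  -- Partial sums and geometric tails

  partialSum : (ℕ → ℚ) → ℕ → ℚ
  partialSum x zero    = 0ℚ
  partialSum x (suc n) = partialSum x n + x n

  partialSum-cong : ∀ {x y} → (∀ k → x k ≡ y k) → ∀ n → partialSum x n ≡ partialSum y n
  partialSum-cong x≗y zero    = refl
  partialSum-cong x≗y (suc n) = cong₂ _+_ (partialSum-cong x≗y n) (x≗y n)

  partialSum-shift : ∀ x n → partialSum x (suc n) ≡ x 0 + partialSum (λ k → x (suc k)) n
  partialSum-shift x zero    = +-comm 0ℚ (x 0)
  partialSum-shift x (suc n) = trans (cong (_+ x (suc n)) (partialSum-shift x n))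
    (+-assoc (x 0) (partialSum (λ k → x (suc k)) n) (x (suc n)))

  ½^-halves : ∀ M k → M * (2ℚ * ½ ^ℚ suc k) ≡ M * ½ ^ℚ k
  ½^-halves M k = solve 2 (λ M h → M :* (con 2ℚ :* (con ½ :* h)) := M :* h) refl M (½ ^ℚ k)

  -- The second summand on the left is the part of the geometric tail not yet spent; it makes the
  -- induction work, since the term bound M½ᵏ is exactly half of the tail 2M½ᵏ and leaves the other
  -- half for later terms.
  tail-bound-+ : ∀ {x M K} → (∀ k → K ℕ.≤ k → ∣ x k ∣ ≤ M * ½ ^ℚ k) →
    ∀ m j → K ℕ.≤ m →
    ∣ partialSum x (j ℕ.+ m) - partialSum x m ∣ + M * (2ℚ * ½ ^ℚ (j ℕ.+ m)) ≤ M * (2ℚ * ½ ^ℚ m)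
  tail-bound-+ {x} {M} bound m zero K≤m = ≤-reflexive
    (trans (cong (λ p → ∣ p ∣ + M * (2ℚ * ½ ^ℚ m)) (+-inverseʳ (partialSum x m)))
           (+-identityˡ (M * (2ℚ * ½ ^ℚ m))))
  tail-bound-+ {x} {M} bound m (suc j) K≤m = begin
    ∣ S k + x k - S m ∣ + M * (2ℚ * ½ ^ℚ suc k)    ≡⟨ cong₂ (λ p q → ∣ p ∣ + q)
                                                       (solve 3 (λ a b c → a :+ b :- c := (a :- c) :+ b) refl (S k) (x k) (S m))
                                                       (½^-halves M k) ⟩
    ∣ (S k - S m) + x k ∣ + M * ½ ^ℚ k             ≤⟨ +-monoˡ-≤ (M * ½ ^ℚ k)
                                                       (∣∣-+-mono {S k - S m} {x k} ≤-refl (bound k (ℕ.≤-trans K≤m (ℕ.m≤n+m m j)))) ⟩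
    ∣ S k - S m ∣ + M * ½ ^ℚ k + M * ½ ^ℚ k         ≡⟨ solve 3 (λ d M h → d :+ M :* h :+ M :* h := d :+ M :* (con 2ℚ :* h))
                                                       refl ∣ S k - S m ∣ M (½ ^ℚ k) ⟩
    ∣ S k - S m ∣ + M * (2ℚ * ½ ^ℚ k)              ≤⟨ tail-bound-+ {x} {M} bound m j K≤m ⟩
    M * (2ℚ * ½ ^ℚ m)                              ∎
    where
    open ≤-Reasoning
    S = partialSum x
    k = j ℕ.+ m

  tail-bound : ∀ {x M K} → 0ℚ ≤ M → (∀ k → K ℕ.≤ k → ∣ x k ∣ ≤ M * ½ ^ℚ k) →
    ∀ {m n} → K ℕ.≤ m → m ℕ.≤ n → ∣ partialSum x n - partialSum x m ∣ ≤ M * (2ℚ * ½ ^ℚ m)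
  tail-bound {x} {M} 0≤M bound {m} {n} K≤m m≤n = subst (λ n → ∣ partialSum x n - partialSum x m ∣ ≤ M * (2ℚ * ½ ^ℚ m))
    (ℕ.m∸n+n≡m m≤n)
    (≤-trans (≤-from-difference (solve 2 (λ d e → d :+ e :- d := e) refl ∣ partialSum x k - partialSum x m ∣ (M * (2ℚ * ½ ^ℚ k)))
                (*-nonNeg 0≤M (*-nonNeg (nonNegative⁻¹ 2ℚ) (^-nonNeg 0≤½ k))))
             (tail-bound-+ {x} {M} bound m (n ℕ.∸ m) K≤m))
    where k = (n ℕ.∸ m) ℕ.+ m

  ½^-antimono : ∀ {m n} → m ℕ.≤ n → ½ ^ℚ n ≤ ½ ^ℚ m
  ½^-antimono {m} {n} m≤n = subst (λ n → ½ ^ℚ n ≤ ½ ^ℚ m) (ℕ.m∸n+n≡m m≤n) (go (n ℕ.∸ m))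
    where
    go : ∀ j → ½ ^ℚ (j ℕ.+ m) ≤ ½ ^ℚ m
    go zero    = ≤-refl
    go (suc j) = ≤-trans
      (≤-from-difference (solve 1 (λ h → h :- con ½ :* h := con ½ :* h) refl (½ ^ℚ (j ℕ.+ m)))
         (*-nonNeg 0≤½ (^-nonNeg 0≤½ (j ℕ.+ m))))
      (go j)

  -- Bernoulli's inequality n + 1 ≤ 2ⁿ, by n + 2 ≤ 2(n + 1). It is the source of every choice of an
  -- index at which a geometric term is small.
  fromℕ-suc-*-½^ : ∀ n → fromℕ (suc n) * ½ ^ℚ n ≤ 1ℚ
  fromℕ-suc-*-½^ zero    = ≤-refl
  fromℕ-suc-*-½^ (suc n) = begin
    fromℕ (suc (suc n)) * (½ * ½ ^ℚ n)                       ≡⟨ cong (_* (½ * ½ ^ℚ n)) (fromℕ-suc (suc n)) ⟩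
    (1ℚ + fromℕ (suc n)) * (½ * ½ ^ℚ n)                      ≤⟨ *-monoˡ-≤ (*-nonNeg 0≤½ (^-nonNeg 0≤½ n))
                                                                 (+-monoˡ-≤ (fromℕ (suc n)) (1≤fromℕ-suc n)) ⟩
    (fromℕ (suc n) + fromℕ (suc n)) * (½ * ½ ^ℚ n)           ≡⟨ solve 2 (λ a h → (a :+ a) :* (con ½ :* h) := a :* h) refl (fromℕ (suc n)) (½ ^ℚ n) ⟩
    fromℕ (suc n) * ½ ^ℚ n                                   ≤⟨ fromℕ-suc-*-½^ n ⟩
    1ℚ                                                      ∎
    where open ≤-Reasoning

  ½^-eventually-small : ∀ {M ε} → 0ℚ ≤ M → 0ℚ < ε → ∃[ N ] (∀ n → N ℕ.≤ n → M * ½ ^ℚ n ≤ ε)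
  ½^-eventually-small {M} {ε} 0≤M 0<ε = N , λ n N≤n → begin
    M * ½ ^ℚ n                        ≤⟨ *-monoʳ-≤ 0≤M (½^-antimono N≤n) ⟩
    M * ½ ^ℚ N                        ≡⟨ cong (_* ½ ^ℚ N) M≡ ⟨
    (M * 1/ ε) * ε * ½ ^ℚ N           ≤⟨ *-monoˡ-≤ (^-nonNeg 0≤½ N) (*-monoˡ-≤ (<⇒≤ 0<ε)
                                          (≤-trans (p≤fromℕ (M * 1/ ε)) (fromℕ-mono (ℕ.n≤1+n N)))) ⟩
    fromℕ (suc N) * ε * ½ ^ℚ N        ≡⟨ solve 3 (λ a e h → a :* e :* h := e :* (a :* h)) refl (fromℕ (suc N)) ε (½ ^ℚ N) ⟩
    ε * (fromℕ (suc N) * ½ ^ℚ N)      ≤⟨ *-monoʳ-≤ (<⇒≤ 0<ε) (fromℕ-suc-*-½^ N) ⟩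
    ε * 1ℚ                           ≡⟨ *-identityʳ ε ⟩
    ε                                ∎
    where
    open ≤-Reasoning
    instance _ = >-nonZero 0<ε
    N = ℤ.∣ ↥ (M * 1/ ε) ∣
    M≡ : (M * 1/ ε) * ε ≡ M
    M≡ = trans (*-assoc M (1/ ε) ε) (trans (cong (M *_) (*-inverseˡ ε)) (*-identityʳ M))

  -- Passing from k to k + 1 multiplies cᵏ/k! by c/(k + 1), which is at most ρ from K on; so the
  -- comparison with Mρᵏ has to be checked only at K.
  exp-bound : ∀ {c ρ M} K → 0ℚ ≤ c → 0ℚ ≤ ρ → c ≤ ρ * fromℕ (suc K) → c ^ℚ K * 1/! K ≤ M * ρ ^ℚ K →
    ∀ k → K ℕ.≤ k → c ^ℚ k * 1/! k ≤ M * ρ ^ℚ k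
  exp-bound {c} {ρ} {M} K 0≤c 0≤ρ c≤ base k K≤k = subst (λ k → c ^ℚ k * 1/! k ≤ M * ρ ^ℚ k) (ℕ.m∸n+n≡m K≤k) (go (k ℕ.∸ K))
    where
    open ≤-Reasoning
    go : ∀ j → c ^ℚ (j ℕ.+ K) * 1/! (j ℕ.+ K) ≤ M * ρ ^ℚ (j ℕ.+ K)
    go zero    = base
    go (suc j) = begin
      c * c ^ℚ i * 1/! (suc i)                          ≡⟨ *-assoc c (c ^ℚ i) (1/! (suc i)) ⟩
      c * (c ^ℚ i * 1/! (suc i))                        ≤⟨ *-monoˡ-≤ (*-nonNeg (^-nonNeg 0≤c i) (1/!-nonNeg (suc i)))
                                                            (≤-trans c≤ (*-monoʳ-≤ 0≤ρ (fromℕ-mono (ℕ.s≤s (ℕ.m≤n+m K j))))) ⟩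
      ρ * fromℕ (suc i) * (c ^ℚ i * 1/! (suc i))        ≡⟨ solve 4 (λ r n a f → r :* n :* (a :* f) := r :* (a :* (n :* f))) refl ρ (fromℕ (suc i)) (c ^ℚ i) (1/! (suc i)) ⟩
      ρ * (c ^ℚ i * (fromℕ (suc i) * 1/! (suc i)))      ≡⟨ cong (λ f → ρ * (c ^ℚ i * f)) (fromℕ-*-1/! i) ⟩
      ρ * (c ^ℚ i * 1/! i)                              ≤⟨ *-monoʳ-≤ 0≤ρ (go j) ⟩
      ρ * (M * ρ ^ℚ i)                                  ≡⟨ solve 3 (λ r M p → r :* (M :* p) := M :* (r :* p)) refl ρ M (ρ ^ℚ i) ⟩
      M * (ρ * ρ ^ℚ i)                                  ∎
      where i = j ℕ.+ K

  -- Coefficients of the series and their bounds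

  ¼ : ℚ
  ¼ = + 1 / 4

  512ℚ : ℚ
  512ℚ = + 512 / 1

  -- The ratio is ¼ and not ½ because the walk counts may contribute another 2ᵏ, which must still
  -- leave ½ᵏ. From k = 7 on, 2/(k + 1) ≤ ¼; and 512 exceeds the maximum of 8ᵏ/k!, which is about
  -- 416.
  exp-2-bound : ∀ k → 2ℚ ^ℚ k * 1/! k ≤ 512ℚ * ¼ ^ℚ k
  exp-2-bound 0 = ≤ᵇ⇒≤ _
  exp-2-bound 1 = ≤ᵇ⇒≤ _
  exp-2-bound 2 = ≤ᵇ⇒≤ _
  exp-2-bound 3 = ≤ᵇ⇒≤ _
  exp-2-bound 4 = ≤ᵇ⇒≤ _
  exp-2-bound 5 = ≤ᵇ⇒≤ _
  exp-2-bound 6 = ≤ᵇ⇒≤ _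
  exp-2-bound k@(suc (suc (suc (suc (suc (suc (suc _))))))) =
    exp-bound {M = 512ℚ} 7 (nonNegative⁻¹ 2ℚ) (nonNegative⁻¹ ¼) (≤ᵇ⇒≤ _) (≤ᵇ⇒≤ _) k
      (ℕ.m≤m+n 7 _)

  -- rePow t k +i imPow t k = (it)ᵏ
  rePow imPow : ℚ → ℕ → ℚ
  rePow t zero    = 1ℚ
  rePow t (suc k) = - (t * imPow t k)
  imPow t zero    = 0ℚ
  imPow t (suc k) = t * rePow t k

  cosCoeff sinCoeff : ℚ → ℕ → ℚ
  cosCoeff t k = rePow t k * 1/! k
  sinCoeff t k = imPow t k * 1/! k

  -- Partial sums of the real part of Σ (it)ᵏ wₖ / k!. Constant weights 1 give cos t, the closed
  -- walk counts give f(t).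
  cosSeries : (ℕ → ℚ) → ℚ → ℕ → ℚ
  cosSeries w t = partialSum (λ k → cosCoeff t k * w k)

  ∣rePow∣-bound : ∀ {t T} → ∣ t ∣ ≤ T → ∀ k → ∣ rePow t k ∣ ≤ T ^ℚ k
  ∣imPow∣-bound : ∀ {t T} → ∣ t ∣ ≤ T → ∀ k → ∣ imPow t k ∣ ≤ T ^ℚ k
  ∣rePow∣-bound         ∣t∣≤T zero    = ≤-refl
  ∣rePow∣-bound {t}     ∣t∣≤T (suc k) = subst (_≤ _) (sym (∣-p∣≡∣p∣ (t * imPow t k)))
    (∣∣-*-mono {t} {imPow t k} ∣t∣≤T (∣imPow∣-bound ∣t∣≤T k))
  ∣imPow∣-bound         ∣t∣≤T zero    = nonNegative⁻¹ 1ℚ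
  ∣imPow∣-bound {t}     ∣t∣≤T (suc k) = ∣∣-*-mono {t} {rePow t k} ∣t∣≤T (∣rePow∣-bound ∣t∣≤T k)

  ∣-*-1/!∣-bound : ∀ {p b} k → ∣ p ∣ ≤ b → ∣ p * 1/! k ∣ ≤ b * 1/! k
  ∣-*-1/!∣-bound {p} k ∣p∣≤b = ∣∣-*-mono {p} {1/! k} ∣p∣≤b (≤-reflexive (0≤p⇒∣p∣≡p (1/!-nonNeg k)))

  ∣cosCoeff∣-bound : ∀ {t T} → ∣ t ∣ ≤ T → ∀ k → ∣ cosCoeff t k ∣ ≤ T ^ℚ k * 1/! k
  ∣cosCoeff∣-bound {t} ∣t∣≤T k = ∣-*-1/!∣-bound {rePow t k} k (∣rePow∣-bound ∣t∣≤T k)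

  ∣sinCoeff∣-bound : ∀ {t T} → ∣ t ∣ ≤ T → ∀ k → ∣ sinCoeff t k ∣ ≤ T ^ℚ k * 1/! k
  ∣sinCoeff∣-bound {t} ∣t∣≤T k = ∣-*-1/!∣-bound {imPow t k} k (∣imPow∣-bound ∣t∣≤T k)

  weighted-bound : ∀ {a w : ℕ → ℚ} → (∀ k → ∣ a k ∣ ≤ 2ℚ ^ℚ k * 1/! k) → (∀ k → ∣ w k ∣ ≤ 2ℚ ^ℚ k) →
    ∀ k → ∣ a k * w k ∣ ≤ 512ℚ * ½ ^ℚ k
  weighted-bound {a} {w} ∣a∣≤ ∣w∣≤ k = begin
    ∣ a k * w k ∣                      ≤⟨ ∣∣-*-mono {a k} {w k} (≤-trans (∣a∣≤ k) (exp-2-bound k)) (∣w∣≤ k) ⟩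
    512ℚ * ¼ ^ℚ k * 2ℚ ^ℚ k              ≡⟨ *-assoc 512ℚ (¼ ^ℚ k) (2ℚ ^ℚ k) ⟩
    512ℚ * (¼ ^ℚ k * 2ℚ ^ℚ k)            ≡⟨ cong (512ℚ *_) (^-distrib-* ¼ 2ℚ k) ⟨
    512ℚ * ½ ^ℚ k                       ∎
    where open ≤-Reasoning

  weighted-tail : ∀ {a w : ℕ → ℚ} → (∀ k → ∣ a k ∣ ≤ 2ℚ ^ℚ k * 1/! k) → (∀ k → ∣ w k ∣ ≤ 2ℚ ^ℚ k) →
    ∀ {m n} → m ℕ.≤ n →
    ∣ partialSum (λ k → a k * w k) n - partialSum (λ k → a k * w k) m ∣ ≤ 512ℚ * (2ℚ * ½ ^ℚ m)
  weighted-tail ∣a∣≤ ∣w∣≤ = tail-bound {K = 0} (nonNegative⁻¹ 512ℚ)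
    (λ k _ → weighted-bound ∣a∣≤ ∣w∣≤ k) ℕ.z≤n

  -- Lipschitz functions on [-2,2]

  record LipschitzOn[-2,2] (f : ℚ → ℚ) : Set where
    field
      {bound constant} : ℚ
      bound-nonNeg     : 0ℚ ≤ bound
      constant-nonNeg  : 0ℚ ≤ constant
      bounded          : ∀ t → ∣ t ∣ ≤ 2ℚ → ∣ f t ∣ ≤ bound
      lipschitz        : ∀ s t → ∣ s ∣ ≤ 2ℚ → ∣ t ∣ ≤ 2ℚ → ∣ f s - f t ∣ ≤ constant * ∣ s - t ∣

  open LipschitzOn[-2,2]

  const-lipschitz : ∀ c → LipschitzOn[-2,2] (λ _ → c)
  const-lipschitz c = record
    { bound-nonNeg    = 0≤∣p∣ c
    ; constant-nonNeg = ≤-refl {0ℚ}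
    ; bounded         = λ _ _ → ≤-refl
    ; lipschitz       = λ s t _ _ → ≤-reflexive (trans (cong ∣_∣ (+-inverseʳ c)) (sym (*-zeroˡ ∣ s - t ∣)))
    }

  id-lipschitz : LipschitzOn[-2,2] (λ t → t)
  id-lipschitz = record
    { bound-nonNeg    = nonNegative⁻¹ 2ℚ
    ; constant-nonNeg = nonNegative⁻¹ 1ℚ
    ; bounded         = λ _ ∣t∣≤2 → ∣t∣≤2
    ; lipschitz       = λ s t _ _ → ≤-reflexive (sym (*-identityˡ ∣ s - t ∣))
    }

  +-lipschitz : ∀ {f g} → LipschitzOn[-2,2] f → LipschitzOn[-2,2] g → LipschitzOn[-2,2] (λ t → f t + g t)
  +-lipschitz {f} {g} F G = record
    { bound-nonNeg    = +-nonNeg (bound-nonNeg F) (bound-nonNeg G)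
    ; constant-nonNeg = +-nonNeg (constant-nonNeg F) (constant-nonNeg G)
    ; bounded         = λ t ∣t∣≤2 → ∣∣-+-mono {f t} {g t} (bounded F t ∣t∣≤2) (bounded G t ∣t∣≤2)
    ; lipschitz       = λ s t ∣s∣≤2 ∣t∣≤2 → subst₂ _≤_
        (cong ∣_∣ (solve 4 (λ a b c d → (a :- c) :+ (b :- d) := a :+ b :- (c :+ d)) refl (f s) (g s) (f t) (g t)))
        (sym (*-distribʳ-+ ∣ s - t ∣ (constant F) (constant G)))
        (∣∣-+-mono {f s - f t} {g s - g t} (lipschitz F s t ∣s∣≤2 ∣t∣≤2) (lipschitz G s t ∣s∣≤2 ∣t∣≤2))
    }

  -- The Lipschitz constant of a product involves the sizes of both factors; this is why the record
  -- carries `bound` besides `constant`.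
  *-lipschitz : ∀ {f g} → LipschitzOn[-2,2] f → LipschitzOn[-2,2] g → LipschitzOn[-2,2] (λ t → f t * g t)
  *-lipschitz {f} {g} F G = record
    { bound-nonNeg    = *-nonNeg (bound-nonNeg F) (bound-nonNeg G)
    ; constant-nonNeg = +-nonNeg (*-nonNeg (bound-nonNeg F) (constant-nonNeg G)) (*-nonNeg (constant-nonNeg F) (bound-nonNeg G))
    ; bounded         = λ t ∣t∣≤2 → ∣∣-*-mono {f t} {g t} (bounded F t ∣t∣≤2) (bounded G t ∣t∣≤2)
    ; lipschitz       = λ s t ∣s∣≤2 ∣t∣≤2 → subst₂ _≤_
        (cong ∣_∣ (solve 4 (λ a b c d → a :* (b :- d) :+ (a :- c) :* d := a :* b :- c :* d) refl (f s) (g s) (f t) (g t)))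
        (solve 5 (λ Bf Lf Bg Lg d → Bf :* (Lg :* d) :+ Lf :* d :* Bg := (Bf :* Lg :+ Lf :* Bg) :* d) refl
          (bound F) (constant F) (bound G) (constant G) ∣ s - t ∣)
        (∣∣-+-mono {f s * (g s - g t)} {(f s - f t) * g t}
          (∣∣-*-mono {f s} {g s - g t} (bounded F s ∣s∣≤2) (lipschitz G s t ∣s∣≤2 ∣t∣≤2))
          (∣∣-*-mono {f s - f t} {g t} (lipschitz F s t ∣s∣≤2 ∣t∣≤2) (bounded G t ∣t∣≤2)))
    }

  neg-lipschitz : ∀ {f} → LipschitzOn[-2,2] f → LipschitzOn[-2,2] (λ t → - f t)
  neg-lipschitz {f} F = record
    { bound-nonNeg    = bound-nonNeg F
    ; constant-nonNeg = constant-nonNeg F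
    ; bounded         = λ t ∣t∣≤2 → subst (_≤ _) (sym (∣-p∣≡∣p∣ (f t))) (bounded F t ∣t∣≤2)
    ; lipschitz       = λ s t ∣s∣≤2 ∣t∣≤2 → subst (_≤ _)
        (trans (∣p-q∣≡∣q-p∣ (f s) (f t)) (cong ∣_∣ (solve 2 (λ a b → b :- a := :- a :- :- b) refl (f s) (f t))))
        (lipschitz F s t ∣s∣≤2 ∣t∣≤2)
    }

  rePow-lipschitz : ∀ k → LipschitzOn[-2,2] (λ t → rePow t k)
  imPow-lipschitz : ∀ k → LipschitzOn[-2,2] (λ t → imPow t k)
  rePow-lipschitz zero    = const-lipschitz 1ℚ
  rePow-lipschitz (suc k) = neg-lipschitz (*-lipschitz id-lipschitz (imPow-lipschitz k))
  imPow-lipschitz zero    = const-lipschitz 0ℚ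
  imPow-lipschitz (suc k) = *-lipschitz id-lipschitz (rePow-lipschitz k)

  cosSeries-lipschitz : ∀ w n → LipschitzOn[-2,2] (λ t → cosSeries w t n)
  cosSeries-lipschitz w zero    = const-lipschitz 0ℚ
  cosSeries-lipschitz w (suc n) = +-lipschitz (cosSeries-lipschitz w n)
    (*-lipschitz (*-lipschitz (rePow-lipschitz n) (const-lipschitz (1/! n))) (const-lipschitz (w n)))

  -- Bisection and approximate roots

  record SignChange (f : ℚ → ℚ) (T : ℚ) (ℓ : ℚ) : Set where
    field
      {left right} : ℚ
      0≤left       : 0ℚ ≤ left
      0<right      : 0ℚ < right
      right≤T      : right ≤ T
      length       : right - left ≡ ℓ
      f-left       : 0ℚ < f left
      f-right      : f right ≤ 0ℚ

  open SignChange

  midpoint : ℚ → ℚ → ℚ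
  midpoint a b = ½ * (a + b)

  right-half : ∀ a b → b - midpoint a b ≡ ½ * (b - a)
  right-half = solve 2 (λ a b → b :- con ½ :* (a :+ b) := con ½ :* (b :- a)) refl

  left-half : ∀ a b → midpoint a b - a ≡ ½ * (b - a)
  left-half = solve 2 (λ a b → con ½ :* (a :+ b) :- a := con ½ :* (b :- a)) refl

  -- The strict sign on the left and the weak one on the right are the two outcomes of deciding
  -- `≤ 0ℚ` at the midpoint. Positivity of `right` survives because the midpoint of a nonnegative
  -- and a positive number is positive; it later supplies t > 0.
  bisectAt : ∀ {f T ℓ} → 0ℚ ≤ ℓ → (I : SignChange f T ℓ) →
    Dec (f (midpoint (left I) (right I)) ≤ 0ℚ) → SignChange f T (½ * ℓ)
  bisectAt 0≤ℓ I (yes fm≤0) = record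
    { 0≤left  = 0≤left I
    ; 0<right = subst (_< midpoint (left I) (right I)) (*-zeroʳ ½) (*-monoʳ-<-pos ½ (+-mono-≤-< (0≤left I) (0<right I)))
    ; right≤T = ≤-trans (≤-from-difference (right-half (left I) (right I))
                          (*-nonNeg 0≤½ (subst (0ℚ ≤_) (sym (length I)) 0≤ℓ))) (right≤T I)
    ; length  = trans (left-half (left I) (right I)) (cong (½ *_) (length I))
    ; f-left  = f-left I
    ; f-right = fm≤0
    }
  bisectAt 0≤ℓ I (no fm≰0) = record
    { 0≤left  = *-nonNeg 0≤½ (+-nonNeg (0≤left I) (<⇒≤ (0<right I)))
    ; 0<right = 0<right I
    ; right≤T = right≤T I
    ; length  = trans (right-half (left I) (right I)) (cong (½ *_) (length I))
    ; f-left  = ≰⇒> fm≰0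
    ; f-right = f-right I
    }

  bisect : ∀ {f T} → 0ℚ < T → 0ℚ < f 0ℚ → f T ≤ 0ℚ → ∀ k → SignChange f T (½ ^ℚ k * T)
  bisect {f} {T} 0<T 0<f0 fT≤0 zero = record
    { 0≤left  = ≤-refl
    ; 0<right = 0<T
    ; right≤T = ≤-refl
    ; length  = solve 1 (λ T → T :- con 0ℚ := con 1ℚ :* T) refl T
    ; f-left  = 0<f0
    ; f-right = fT≤0
    }
  bisect {f} {T} 0<T 0<f0 fT≤0 (suc k) = subst (SignChange f T) (sym (*-assoc ½ (½ ^ℚ k) T))
    (bisectAt (*-nonNeg (^-nonNeg 0≤½ k) (<⇒≤ 0<T)) I (f (midpoint (left I) (right I)) ≤? 0ℚ))
    where I = bisect {f} 0<T 0<f0 fT≤0 k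

  -- Since f(left) > 0 ≥ f(right), the size of f(right) is at most f(left) - f(right), which the
  -- Lipschitz constant controls by the length of the interval.
  ∣f-right∣-bound : ∀ {f T ℓ} (F : LipschitzOn[-2,2] f) → T ≤ 2ℚ → 0ℚ ≤ ℓ → (I : SignChange f T ℓ) →
    ∣ f (right I) ∣ ≤ constant F * ℓ
  ∣f-right∣-bound {f} {T} {ℓ} F T≤2 0≤ℓ I = begin
    ∣ f b ∣                      ≡⟨ ∣-p∣≡∣p∣ (f b) ⟨
    ∣ - f b ∣                    ≡⟨ 0≤p⇒∣p∣≡p (neg-antimono-≤ (f-right I)) ⟩
    - f b                        ≡⟨ +-identityˡ (- f b) ⟨
    0ℚ - f b                     ≤⟨ +-monoˡ-≤ (- f b) (<⇒≤ (f-left I)) ⟩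
    f a - f b                    ≤⟨ p≤∣p∣ (f a - f b) ⟩
    ∣ f a - f b ∣                ≤⟨ lipschitz F a b (∣∣≤2 (0≤left I) (≤-trans a≤b (right≤T I))) (∣∣≤2 (<⇒≤ (0<right I)) (right≤T I)) ⟩
    constant F * ∣ a - b ∣       ≡⟨ cong (constant F *_) (trans (∣p-q∣≡∣q-p∣ a b) (trans (0≤p⇒∣p∣≡p 0≤b-a) (length I))) ⟩
    constant F * ℓ               ∎
    where
    open ≤-Reasoning
    a = left I
    b = right I
    0≤b-a : 0ℚ ≤ b - a
    0≤b-a = subst (0ℚ ≤_) (sym (length I)) 0≤ℓ
    a≤b : a ≤ b
    a≤b = ≤-from-difference refl 0≤b-a
    ∣∣≤2 : ∀ {p} → 0ℚ ≤ p → p ≤ T → ∣ p ∣ ≤ 2ℚ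
    ∣∣≤2 0≤p p≤T = subst (_≤ 2ℚ) (sym (0≤p⇒∣p∣≡p 0≤p)) (≤-trans p≤T T≤2)

  approximate-root : ∀ {f T} → LipschitzOn[-2,2] f → 0ℚ < T → T ≤ 2ℚ → 0ℚ < f 0ℚ → f T ≤ 0ℚ →
    ∀ δ → 0ℚ < δ → ∃[ t ] (0ℚ < t × t ≤ T × ∣ f t ∣ ≤ δ)
  approximate-root {f} {T} F 0<T T≤2 0<f0 fT≤0 δ 0<δ =
    let k , small = ½^-eventually-small {constant F * T} (*-nonNeg (constant-nonNeg F) (<⇒≤ 0<T)) 0<δ
        I         = bisect {f} 0<T 0<f0 fT≤0 k
    in right I , 0<right I , right≤T I , (begin
      ∣ f (right I) ∣              ≤⟨ ∣f-right∣-bound F T≤2 (*-nonNeg (^-nonNeg 0≤½ k) (<⇒≤ 0<T)) I ⟩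
      constant F * (½ ^ℚ k * T)     ≡⟨ solve 3 (λ c h T → c :* (h :* T) := c :* T :* h) refl (constant F) (½ ^ℚ k) T ⟩
      constant F * T * ½ ^ℚ k       ≤⟨ small k ℕ.≤-refl ⟩
      δ                            ∎)
    where open ≤-Reasoning

  cosSeries-0 : ∀ w n → cosSeries w 0ℚ (suc n) ≡ w 0
  cosSeries-0 w zero    = solve 1 (λ w → con 0ℚ :+ con 1ℚ :* con (1/! 0) :* w := w) refl (w 0)
  cosSeries-0 w (suc n) = trans
    (cong₂ _+_ (cosSeries-0 w n)
      (solve 3 (λ i f w → (:- (con 0ℚ :* i)) :* f :* w := con 0ℚ) refl (imPow 0ℚ n) (1/! (suc n)) (w (suc n))))
    (+-identityʳ (w 0))

  ½*-pos : ∀ {p} → 0ℚ < p → 0ℚ < ½ * p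
  ½*-pos {p} 0<p = subst (_< ½ * p) (*-zeroʳ ½) (*-monoʳ-<-pos ½ 0<p)

  cosSeries-tail : ∀ {t w} → ∣ t ∣ ≤ 2ℚ → (∀ k → ∣ w k ∣ ≤ 2ℚ ^ℚ k) → ∀ {m n} → m ℕ.≤ n →
    ∣ cosSeries w t n - cosSeries w t m ∣ ≤ 512ℚ * (2ℚ * ½ ^ℚ m)
  cosSeries-tail ∣t∣≤2 ∣w∣≤ = weighted-tail (∣cosCoeff∣-bound ∣t∣≤2) ∣w∣≤

  tail-eventually-small : ∀ {δ} → 0ℚ < δ → ∃[ K ] (∀ n → K ℕ.≤ n → 512ℚ * (2ℚ * ½ ^ℚ n) ≤ δ)
  tail-eventually-small {δ} 0<δ =
    let K , small = ½^-eventually-small {512ℚ * 2ℚ} (nonNegative⁻¹ (512ℚ * 2ℚ)) 0<δ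
    in K , λ n K≤n → subst (_≤ δ) (*-assoc 512ℚ 2ℚ (½ ^ℚ n)) (small n K≤n)

  ∣∣≤-of-0<≤ : ∀ {t T} → 0ℚ < t → t ≤ T → ∣ t ∣ ≤ T
  ∣∣≤-of-0<≤ {T = T} 0<t = subst (_≤ T) (sym (0≤p⇒∣p∣≡p (<⇒≤ 0<t)))

  -- Because the tail bound is uniform in t, the index N can be fixed from δ before t is known.
  -- Bisection then makes the N-th partial sum at most δ/2, and later partial sums differ from it by
  -- at most δ/2. As N depends on δ, the sign at T is assumed for all indices from K on.
  cosSeries-root : ∀ {w T} → (∀ k → ∣ w k ∣ ≤ 2ℚ ^ℚ k) → w 0 ≡ 1ℚ → 0ℚ < T → T ≤ 2ℚ →
    ∀ K → (∀ n → K ℕ.≤ n → cosSeries w T n ≤ 0ℚ) →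
    ∀ δ → 0ℚ < δ → ∃[ t ] (0ℚ < t × t ≤ 2ℚ × ∃[ N ] (∀ n → N ℕ.≤ n → ∣ cosSeries w t n ∣ ≤ δ))
  cosSeries-root {w} {T} ∣w∣≤ w0≡1 0<T T≤2 K nonPos δ 0<δ =
    let K′ , small           = tail-eventually-small (½*-pos 0<δ)
        -- A successor, so that the partial sum contains the constant term and has the value w₀ = 1
        -- at t = 0.
        N                    = suc (K ℕ.⊔ K′)
        K≤N                  = ℕ.≤-trans (ℕ.m≤m⊔n K K′) (ℕ.n≤1+n (K ℕ.⊔ K′))
        K′≤N                 = ℕ.≤-trans (ℕ.m≤n⊔m K K′) (ℕ.n≤1+n (K ℕ.⊔ K′))
        t , 0<t , t≤T , ∣F∣≤ = approximate-root (cosSeries-lipschitz w N) 0<T T≤2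
                                 (subst (0ℚ <_) (sym (trans (cosSeries-0 w (K ℕ.⊔ K′)) w0≡1)) (positive⁻¹ 1ℚ))
                                 (nonPos N K≤N) (½ * δ) (½*-pos 0<δ)
        t≤2                  = ≤-trans t≤T T≤2
        F                    = cosSeries w t
    in t , 0<t , t≤2 , N , λ n N≤n → begin
      ∣ F n ∣                      ≡⟨ cong ∣_∣ (solve 2 (λ a b → a := (a :- b) :+ b) refl (F n) (F N)) ⟩
      ∣ (F n - F N) + F N ∣        ≤⟨ ∣∣-+-mono {F n - F N} {F N}
                                        (≤-trans (cosSeries-tail {t} {w} (∣∣≤-of-0<≤ 0<t t≤2) ∣w∣≤ N≤n) (small N K′≤N)) ∣F∣≤ ⟩
      ½ * δ + ½ * δ                ≡⟨ solve 1 (λ d → con ½ :* d :+ con ½ :* d := d) refl δ ⟩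
      δ                            ∎
    where open ≤-Reasoning

  -- Cauchy products

  conv : (ℕ → ℚ) → (ℕ → ℚ) → ℕ → ℚ
  conv a b zero    = a 0 * b 0
  conv a b (suc m) = a 0 * b (suc m) + conv (λ k → a (suc k)) b m

  -- The triangle of products aⱼbₖ with j + k ≤ n is cut by j: the row j = 0 is a₀ times a full
  -- partial sum of b, and the other rows form the smaller triangle of the shifted sequence.
  partialSum-conv : ∀ a b n → partialSum (conv a b) (suc n) ≡
    a 0 * partialSum b (suc n) + partialSum (conv (λ k → a (suc k)) b) n
  partialSum-conv a b zero    = solve 2 (λ a b → con 0ℚ :+ a :* b := a :* (con 0ℚ :+ b) :+ con 0ℚ) refl (a 0) (b 0)
  partialSum-conv a b (suc n) = trans (cong (_+ conv a b (suc n)) (partialSum-conv a b n))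
    (solve 5 (λ a S T b c → a :* S :+ T :+ (a :* b :+ c) := a :* (S :+ b) :+ (T :+ c)) refl
      (a 0) (partialSum b (suc n)) (partialSum (conv (λ k → a (suc k)) b) n) (b (suc n)) (conv (λ k → a (suc k)) b n))

  -- Mertens: Σ_{m<n} conv a b m = Σ_{j<n} aⱼ (Σ_{k<n-j} bₖ), so the error is Σ_{j<n} aⱼ times a tail of b.
  partialSum-*-conv : ∀ {a b M L B} n → 0ℚ ≤ L → (∀ j → ∣ a j ∣ ≤ M * ¼ ^ℚ j) →
    (∀ m → m ℕ.≤ n → ∣ B - partialSum b m ∣ ≤ L * ½ ^ℚ m) →
    ∣ partialSum a n * B - partialSum (conv a b) n ∣ ≤ M * (2ℚ * (L * ½ ^ℚ n))
  partialSum-*-conv {a} {b} {M} {L} {B} zero 0≤L ∣a∣≤ tail =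
    subst (_≤ M * (2ℚ * (L * 1ℚ))) (cong ∣_∣ (solve 1 (λ B → con 0ℚ := con 0ℚ :* B :- con 0ℚ) refl B))
      (*-nonNeg 0≤M (*-nonNeg (nonNegative⁻¹ 2ℚ) (*-nonNeg 0≤L (nonNegative⁻¹ 1ℚ))))
    where
    0≤M : 0ℚ ≤ M
    0≤M = ≤-trans (0≤∣p∣ (a 0)) (subst (∣ a 0 ∣ ≤_) (*-identityʳ M) (∣a∣≤ 0))
  partialSum-*-conv {a} {b} {M} {L} {B} (suc n) 0≤L ∣a∣≤ tail = begin
    ∣ S (suc n) * B - C (suc n) ∣                                ≡⟨ cong₂ (λ p q → ∣ p * B - q ∣) (partialSum-shift a n) (partialSum-conv a b n) ⟩
    ∣ (a 0 + S′) * B - (a 0 * T + C′) ∣                          ≡⟨ cong ∣_∣ (solve 5 (λ a S B T C →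
                                                                      (a :+ S) :* B :- (a :* T :+ C) := a :* (B :- T) :+ (S :* B :- C)) refl (a 0) S′ B T C′) ⟩
    ∣ a 0 * (B - T) + (S′ * B - C′) ∣                            ≤⟨ ∣∣-+-mono {a 0 * (B - T)} {S′ * B - C′}
                                                                      (∣∣-*-mono {a 0} {B - T} (∣a∣≤ 0) (tail (suc n) ℕ.≤-refl))
                                                                      (partialSum-*-conv {a′} {b} {M * ¼} n 0≤L ∣a′∣≤
                                                                        (λ m m≤n → tail m (ℕ.≤-trans m≤n (ℕ.n≤1+n n)))) ⟩
    M * 1ℚ * (L * (½ * ½ ^ℚ n)) + M * ¼ * (2ℚ * (L * ½ ^ℚ n))      ≡⟨ solve 3 (λ M L h → M :* con 1ℚ :* (L :* (con ½ :* h)) :+ M :* con ¼ :* (con 2ℚ :* (L :* h))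
                                                                      := M :* (con 2ℚ :* (L :* (con ½ :* h)))) refl M L (½ ^ℚ n) ⟩
    M * (2ℚ * (L * (½ * ½ ^ℚ n)))                                 ∎
    where
    open ≤-Reasoning
    a′ = λ k → a (suc k)
    S = partialSum a
    C = partialSum (conv a b)
    S′ = partialSum a′ n
    C′ = partialSum (conv a′ b) n
    T = partialSum b (suc n)
    ∣a′∣≤ : ∀ j → ∣ a′ j ∣ ≤ M * ¼ * ¼ ^ℚ j
    ∣a′∣≤ j = subst (∣ a′ j ∣ ≤_) (sym (*-assoc M ¼ (¼ ^ℚ j))) (∣a∣≤ (suc j))

  -- Formal derivatives and double-angle formulas

  conv-scaleˡ : ∀ {a a′ b c} → (∀ k → a′ k ≡ c * a k) → ∀ m → conv a′ b m ≡ c * conv a b m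
  conv-scaleˡ {a} {a′} {b} {c} a′≡ca zero    = trans (cong (_* b 0) (a′≡ca 0)) (*-assoc c (a 0) (b 0))
  conv-scaleˡ {a} {a′} {b} {c} a′≡ca (suc m) = trans
    (cong₂ (λ p q → p * b (suc m) + q) (a′≡ca 0) (conv-scaleˡ {λ k → a (suc k)} {c = c} (λ k → a′≡ca (suc k)) m))
    (solve 4 (λ c a b d → c :* a :* b :+ c :* d := c :* (a :* b :+ d)) refl c (a 0) (b (suc m)) (conv (λ k → a (suc k)) b m))

  conv-scaleʳ : ∀ {a b b′ c} → (∀ k → b′ k ≡ c * b k) → ∀ m → conv a b′ m ≡ c * conv a b m
  conv-scaleʳ {a} {b} {b′} {c} b′≡cb zero    = trans (cong (a 0 *_) (b′≡cb 0))
    (solve 3 (λ a c b → a :* (c :* b) := c :* (a :* b)) refl (a 0) c (b 0))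
  conv-scaleʳ {a} {b} {b′} {c} b′≡cb (suc m) = trans
    (cong₂ (λ p q → a 0 * p + q) (b′≡cb (suc m)) (conv-scaleʳ {λ k → a (suc k)} {b} {c = c} b′≡cb m))
    (solve 4 (λ c a b d → a :* (c :* b) :+ c :* d := c :* (a :* b :+ d)) refl c (a 0) (b (suc m)) (conv (λ k → a (suc k)) b m))

  -- For the formal power series a(x), these are the coefficients of x a′(x) and of a′(x).
  euler derivative : (ℕ → ℚ) → ℕ → ℚ
  euler      a k = fromℕ k * a k
  derivative a k = fromℕ (suc k) * a (suc k)

  conv-+ˡ : ∀ {a a′ c b} → (∀ k → c k ≡ a k + a′ k) → ∀ m → conv c b m ≡ conv a b m + conv a′ b m
  conv-+ˡ {a} {a′} {c} {b} c≡ zero    = trans (cong (_* b 0) (c≡ 0)) (*-distribʳ-+ (b 0) (a 0) (a′ 0))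
  conv-+ˡ {a} {a′} {c} {b} c≡ (suc m) = trans
    (cong₂ (λ p q → p * b (suc m) + q) (c≡ 0) (conv-+ˡ {λ k → a (suc k)} {λ k → a′ (suc k)} (λ k → c≡ (suc k)) m))
    (solve 5 (λ a a′ b d e → (a :+ a′) :* b :+ (d :+ e) := (a :* b :+ d) :+ (a′ :* b :+ e)) refl
      (a 0) (a′ 0) (b (suc m)) (conv (λ k → a (suc k)) b m) (conv (λ k → a′ (suc k)) b m))

  derivative≡ : ∀ a k → derivative a k ≡ a (suc k) + euler (λ k → a (suc k)) k
  derivative≡ a k = trans (cong (_* a (suc k)) (fromℕ-suc k))
    (solve 2 (λ n a → (con 1ℚ :+ n) :* a := a :+ n :* a) refl (fromℕ k) (a (suc k)))

  -- The weights k and m - k of the two factors add up to m. This product rule comes before the one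
  -- for `derivative` because x d/dx preserves degrees, so both sides stay at degree m throughout
  -- the induction.
  conv-euler : ∀ a b m → conv (euler a) b m + conv a (euler b) m ≡ fromℕ m * conv a b m
  conv-euler a b zero    = solve 2 (λ a b → con 0ℚ :* a :* b :+ a :* (con 0ℚ :* b) := con 0ℚ :* (a :* b)) refl (a 0) (b 0)
  conv-euler a b (suc m) = begin
    (0ℚ * a 0 * b′ + conv (derivative a) b m) + (a 0 * (n * b′) + conv a′ (euler b) m)
      ≡⟨ cong (λ p → (0ℚ * a 0 * b′ + p) + (a 0 * (n * b′) + conv a′ (euler b) m)) (conv-+ˡ (derivative≡ a) m) ⟩
    (0ℚ * a 0 * b′ + (conv a′ b m + conv (euler a′) b m)) + (a 0 * (n * b′) + conv a′ (euler b) m)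
      ≡⟨ solve 6 (λ a b n p q r → (con 0ℚ :* a :* b :+ (p :+ q)) :+ (a :* (n :* b) :+ r) := a :* (n :* b) :+ (p :+ (q :+ r))) refl
           (a 0) b′ n (conv a′ b m) (conv (euler a′) b m) (conv a′ (euler b) m) ⟩
    a 0 * (n * b′) + (conv a′ b m + (conv (euler a′) b m + conv a′ (euler b) m))
      ≡⟨ cong₂ (λ p q → a 0 * (p * b′) + (conv a′ b m + q)) (fromℕ-suc m) (conv-euler a′ b m) ⟩
    a 0 * ((1ℚ + fromℕ m) * b′) + (conv a′ b m + fromℕ m * conv a′ b m)
      ≡⟨ solve 4 (λ a n b p → a :* ((con 1ℚ :+ n) :* b) :+ (p :+ n :* p) := (con 1ℚ :+ n) :* (a :* b :+ p)) refl
           (a 0) (fromℕ m) b′ (conv a′ b m) ⟩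
    (1ℚ + fromℕ m) * (a 0 * b′ + conv a′ b m)
      ≡⟨ cong (_* (a 0 * b′ + conv a′ b m)) (fromℕ-suc m) ⟨
    n * (a 0 * b′ + conv a′ b m) ∎
    where
    open ≡-Reasoning
    a′ = λ k → a (suc k)
    b′ = b (suc m)
    n  = fromℕ (suc m)

  conv-derivativeʳ : ∀ a b m → conv a (euler b) (suc m) ≡ conv a (derivative b) m
  conv-derivativeʳ a b zero    = solve 4 (λ a c d b → a :* c :+ d :* (con 0ℚ :* b) := a :* c) refl (a 0) (derivative b 0) (a 1) (b 0)
  conv-derivativeʳ a b (suc m) = cong (_+_ (a 0 * derivative b (suc m))) (conv-derivativeʳ (λ k → a (suc k)) b m)

  conv-derivative : ∀ a b m → fromℕ (suc m) * conv a b (suc m) ≡ conv (derivative a) b m + conv a (derivative b) m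
  conv-derivative a b m = trans (sym (conv-euler a b (suc m)))
    (cong₂ _+_ (solve 3 (λ a b p → con 0ℚ :* a :* b :+ p := p) refl (a 0) (b (suc m)) (conv (derivative a) b m))
               (conv-derivativeʳ a b m))

  *-1/!-suc : ∀ p k → fromℕ (suc k) * (p * 1/! (suc k)) ≡ p * 1/! k
  *-1/!-suc p k = trans
    (solve 3 (λ n p f → n :* (p :* f) := p :* (n :* f)) refl (fromℕ (suc k)) p (1/! (suc k)))
    (cong (p *_) (fromℕ-*-1/! k))

  -- `cosCoeff t` lists the coefficients of cos(tx) in powers of x, whose derivative is -t sin(tx).
  derivative-cosCoeff : ∀ t k → derivative (cosCoeff t) k ≡ - t * sinCoeff t k
  derivative-cosCoeff t k = trans (*-1/!-suc (- (t * imPow t k)) k)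
    (solve 3 (λ t p f → (:- (t :* p)) :* f := (:- t) :* (p :* f)) refl t (imPow t k) (1/! k))

  derivative-sinCoeff : ∀ t k → derivative (sinCoeff t) k ≡ t * cosCoeff t k
  derivative-sinCoeff t k = trans (*-1/!-suc (t * rePow t k) k) (*-assoc t (rePow t k) (1/! k))

  *-cancelˡ-≡ : ∀ {r p q} → 0ℚ < r → r * p ≡ r * q → p ≡ q
  *-cancelˡ-≡ {r} 0<r rp≡rq = ≤-antisym
    (*-cancelˡ-≤-pos r {{positive 0<r}} (≤-reflexive rp≡rq))
    (*-cancelˡ-≤-pos r {{positive 0<r}} (≤-reflexive (sym rp≡rq)))

  ½-at-0 : ℕ → ℚ
  ½-at-0 zero    = ½
  ½-at-0 (suc _) = 0ℚ

  -- cos² t = ½ + ½ cos 2t, sin t cos t = ½ sin 2t and sin² t = ½ - ½ cos 2t.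
  record DoubleAngle (t : ℚ) (m : ℕ) : Set where
    field
      cos-cos : conv (cosCoeff t) (cosCoeff t) m ≡ ½ * 2ℚ ^ℚ m * cosCoeff t m + ½-at-0 m
      cos-sin : conv (cosCoeff t) (sinCoeff t) m ≡ ½ * 2ℚ ^ℚ m * sinCoeff t m
      sin-cos : conv (sinCoeff t) (cosCoeff t) m ≡ ½ * 2ℚ ^ℚ m * sinCoeff t m
      sin-sin : conv (sinCoeff t) (sinCoeff t) m ≡ ½-at-0 m - ½ * 2ℚ ^ℚ m * cosCoeff t m

  -- The product rule expresses m + 1 times a coefficient of degree m + 1 through coefficients of
  -- degree m of the other products, so the four identities need each other and are proved together.
  -- The constants ½ from cos² and sin² cancel in the derivatives of the mixed products.
  double-angle : ∀ t m → DoubleAngle t m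
  double-angle t zero = record { cos-cos = refl ; cos-sin = refl ; sin-cos = refl ; sin-sin = refl }
  double-angle t (suc m) = record
    { cos-cos = by-derivative {c} {s} {c} {s} { - t} { - t} (derivative-cosCoeff t) (derivative-cosCoeff t) (begin
        - t * conv s c m + - t * conv c s m
          ≡⟨ cong₂ (λ p q → - t * p + - t * q) sin-cos cos-sin ⟩
        - t * (½ * P * s m) + - t * (½ * P * s m)
          ≡⟨ solve 3 (λ t P s → (:- t) :* (con ½ :* P :* s) :+ (:- t) :* (con ½ :* P :* s) := con ½ :* (con 2ℚ :* P) :* ((:- t) :* s)) refl t P (s m) ⟩
        ½ * (2ℚ * P) * (- t * s m)
          ≡⟨ cong (½ * (2ℚ * P) *_) (derivative-cosCoeff t m) ⟨
        ½ * (2ℚ * P) * (n * c (suc m))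
          ≡⟨ solve 3 (λ P n c → con ½ :* (con 2ℚ :* P) :* (n :* c) := n :* (con ½ :* (con 2ℚ :* P) :* c :+ con 0ℚ)) refl P n (c (suc m)) ⟩
        n * (½ * (2ℚ * P) * c (suc m) + 0ℚ) ∎)
    ; cos-sin = by-derivative {c} {s} {s} {c} { - t} {t} (derivative-cosCoeff t) (derivative-sinCoeff t) (begin
        - t * conv s s m + t * conv c c m
          ≡⟨ cong₂ (λ p q → - t * p + t * q) sin-sin cos-cos ⟩
        - t * (e - ½ * P * c m) + t * (½ * P * c m + e)
          ≡⟨ solve 4 (λ t P c e → (:- t) :* (e :- con ½ :* P :* c) :+ t :* (con ½ :* P :* c :+ e) := con ½ :* (con 2ℚ :* P) :* (t :* c)) refl t P (c m) e ⟩
        ½ * (2ℚ * P) * (t * c m)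
          ≡⟨ sin-step ⟩
        n * (½ * (2ℚ * P) * s (suc m)) ∎)
    ; sin-cos = by-derivative {s} {c} {c} {s} {t} { - t} (derivative-sinCoeff t) (derivative-cosCoeff t) (begin
        t * conv c c m + - t * conv s s m
          ≡⟨ cong₂ (λ p q → t * p + - t * q) cos-cos sin-sin ⟩
        t * (½ * P * c m + e) + - t * (e - ½ * P * c m)
          ≡⟨ solve 4 (λ t P c e → t :* (con ½ :* P :* c :+ e) :+ (:- t) :* (e :- con ½ :* P :* c) := con ½ :* (con 2ℚ :* P) :* (t :* c)) refl t P (c m) e ⟩
        ½ * (2ℚ * P) * (t * c m)
          ≡⟨ sin-step ⟩
        n * (½ * (2ℚ * P) * s (suc m)) ∎)
    ; sin-sin = by-derivative {s} {c} {s} {c} {t} {t} (derivative-sinCoeff t) (derivative-sinCoeff t) (begin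
        t * conv c s m + t * conv s c m
          ≡⟨ cong₂ (λ p q → t * p + t * q) cos-sin sin-cos ⟩
        t * (½ * P * s m) + t * (½ * P * s m)
          ≡⟨ solve 3 (λ t P s → t :* (con ½ :* P :* s) :+ t :* (con ½ :* P :* s) := :- (con ½ :* (con 2ℚ :* P) :* ((:- t) :* s))) refl t P (s m) ⟩
        - (½ * (2ℚ * P) * (- t * s m))
          ≡⟨ cong (λ p → - (½ * (2ℚ * P) * p)) (derivative-cosCoeff t m) ⟨
        - (½ * (2ℚ * P) * (n * c (suc m)))
          ≡⟨ solve 3 (λ P n c → :- (con ½ :* (con 2ℚ :* P) :* (n :* c)) := n :* (con 0ℚ :- con ½ :* (con 2ℚ :* P) :* c)) refl P n (c (suc m)) ⟩
        n * (0ℚ - ½ * (2ℚ * P) * c (suc m)) ∎)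
    }
    where
    open ≡-Reasoning
    open DoubleAngle (double-angle t m)
    c = cosCoeff t
    s = sinCoeff t
    P = 2ℚ ^ℚ m
    n = fromℕ (suc m)
    e = ½-at-0 m
    by-derivative : ∀ {a a′ b b′ α β q} → (∀ k → derivative a k ≡ α * a′ k) → (∀ k → derivative b k ≡ β * b′ k) →
      α * conv a′ b m + β * conv a b′ m ≡ n * q → conv a b (suc m) ≡ q
    by-derivative {a} {a′} {b} {b′} {α} {β} a∂ b∂ eq = *-cancelˡ-≡ (<-≤-trans (positive⁻¹ 1ℚ) (1≤fromℕ-suc m))
      (trans (conv-derivative a b m) (trans (cong₂ _+_ (conv-scaleˡ {a′} {c = α} a∂ m) (conv-scaleʳ {a} {b′} {c = β} b∂ m)) eq))
    sin-step : ½ * (2ℚ * P) * (t * c m) ≡ n * (½ * (2ℚ * P) * s (suc m))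
    sin-step = trans (cong (½ * (2ℚ * P) *_) (sym (derivative-sinCoeff t m)))
      (solve 3 (λ P n s → con ½ :* (con 2ℚ :* P) :* (n :* s) := n :* (con ½ :* (con 2ℚ :* P) :* s)) refl P n (s (suc m)))

  -- Signs of partial sums, and the squared cosine

  partialSum-nonPos : ∀ {x M K q} → 0ℚ ≤ M → (∀ k → K ℕ.≤ k → ∣ x k ∣ ≤ M * ½ ^ℚ k) →
    partialSum x K ≤ q → q + M * (2ℚ * ½ ^ℚ K) ≤ 0ℚ → ∀ n → K ℕ.≤ n → partialSum x n ≤ 0ℚ
  partialSum-nonPos {x} {M} {K} {q} 0≤M bound S≤q q+tail≤0 n K≤n = begin
    S n                          ≡⟨ solve 2 (λ a b → a := b :+ (a :- b)) refl (S n) (S K) ⟩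
    S K + (S n - S K)            ≤⟨ +-mono-≤ S≤q (≤-trans (p≤∣p∣ (S n - S K)) (tail-bound {x} {M} {K} 0≤M bound ℕ.≤-refl K≤n)) ⟩
    q + M * (2ℚ * ½ ^ℚ K)         ≤⟨ q+tail≤0 ⟩
    0ℚ                           ∎
    where
    open ≤-Reasoning
    S = partialSum x

  -- The terms with k < 6 sum to 1 - 2 + 2/3 = -1/3, while the tail is at most 6 · 2/2⁶ = 3/16. The
  -- factor 6 suffices since 2⁶/6! ≤ 6/2⁶.
  cos-2-nonPos : ∀ n → 6 ℕ.≤ n → cosSeries (λ _ → 1ℚ) 2ℚ n ≤ 0ℚ
  cos-2-nonPos = partialSum-nonPos {M = 6ℚ} (nonNegative⁻¹ 6ℚ)
    (λ k 6≤k → subst (_≤ 6ℚ * ½ ^ℚ k) (cong ∣_∣ (sym (*-identityʳ (cosCoeff 2ℚ k))))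
      (≤-trans (∣cosCoeff∣-bound {2ℚ} ≤-refl k)
        (exp-bound {M = 6ℚ} 6 (nonNegative⁻¹ 2ℚ) 0≤½ (≤ᵇ⇒≤ _) (≤ᵇ⇒≤ _) k 6≤k)))
    (≤-refl {partialSum (λ k → cosCoeff 2ℚ k * 1ℚ) 6}) (≤ᵇ⇒≤ _)


  0<⊓ : ∀ {p q} → 0ℚ < p → 0ℚ < q → 0ℚ < p ⊓ q
  0<⊓ {p} {q} 0<p 0<q = go (⊓-sel p q)
    where
    go : p ⊓ q ≡ p ⊎ p ⊓ q ≡ q → 0ℚ < p ⊓ q
    go (inj₁ e) = subst (0ℚ <_) (sym e) 0<p
    go (inj₂ e) = subst (0ℚ <_) (sym e) 0<q

  cos²Series-root : ∀ {w} → (∀ t k → cosCoeff t k * w k ≡ conv (cosCoeff t) (cosCoeff t) k) →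
    ∀ δ → 0ℚ < δ → ∃[ t ] (0ℚ < t × t ≤ 2ℚ × ∃[ N ] (∀ n → N ℕ.≤ n → ∣ cosSeries w t n ∣ ≤ δ))
  cos²Series-root {w} w-cos² δ 0<δ =
    let t , 0<t , t≤2 , N₁ , ∣P∣≤ = cosSeries-root {λ _ → 1ℚ} ∣1∣≤ refl (positive⁻¹ 2ℚ) ≤-refl 6 cos-2-nonPos
                                      δ′ (0<⊓ (½*-pos 0<δ) (positive⁻¹ 1ℚ))
        N₂ , small                = ½^-eventually-small {512ℚ * (2ℚ * L)} (nonNegative⁻¹ (512ℚ * (2ℚ * L))) (½*-pos 0<δ)
        c                         = cosCoeff t
        P                         = partialSum c
        C                         = partialSum (conv c c)
        ∣t∣≤2                     = ∣∣≤-of-0<≤ 0<t t≤2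
        P≡                        = partialSum-cong {λ k → c k * 1ℚ} {c} (λ k → *-identityʳ (c k))
        ∣c∣≤                      = λ k → ≤-trans (∣cosCoeff∣-bound ∣t∣≤2 k) (exp-2-bound k)
    in t , 0<t , t≤2 , N₁ ℕ.⊔ N₂ , λ n N≤n →
      let N₁≤n  = ℕ.m⊔n≤o⇒m≤o N₁ N₂ N≤n
          N₂≤n  = ℕ.m⊔n≤o⇒n≤o N₁ N₂ N≤n
          ∣P∣≤δ′ = subst (λ p → ∣ p ∣ ≤ δ′) (P≡ n) (∣P∣≤ n N₁≤n)
          -- Tails are measured from P n instead of from the limit: the product estimate is applied
          -- with `B` equal to P n, so it compares C n with the square of P n and no real number cos
          -- t enters.
          tail  = λ m m≤n → subst₂ _≤_ (cong₂ (λ p q → ∣ p - q ∣) (P≡ n) (P≡ m)) (sym (*-assoc 512ℚ 2ℚ (½ ^ℚ m)))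
                    (cosSeries-tail {t} {λ _ → 1ℚ} ∣t∣≤2 ∣1∣≤ m≤n)
      in begin
        ∣ cosSeries w t n ∣                          ≡⟨ cong ∣_∣ (partialSum-cong (w-cos² t) n) ⟩
        ∣ C n ∣                                      ≡⟨ cong ∣_∣ (solve 2 (λ C p → C := p :+ (C :- p)) refl (C n) (P n * P n)) ⟩
        ∣ P n * P n + (C n - P n * P n) ∣            ≤⟨ ∣∣-+-mono {P n * P n} {C n - P n * P n}
                                                          (∣∣-*-mono {P n} {P n} ∣P∣≤δ′ (≤-trans ∣P∣≤δ′ (p⊓q≤q (½ * δ) 1ℚ)))
                                                          (subst (_≤ 512ℚ * (2ℚ * (L * ½ ^ℚ n))) (∣p-q∣≡∣q-p∣ (P n * P n) (C n))
                                                            (partialSum-*-conv {c} {c} {512ℚ} n (nonNegative⁻¹ L) ∣c∣≤ tail)) ⟩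
        δ′ * 1ℚ + 512ℚ * (2ℚ * (L * ½ ^ℚ n))          ≡⟨ cong₂ _+_ (*-identityʳ δ′)
                                                          (solve 4 (λ a b c h → a :* (b :* (c :* h)) := a :* (b :* c) :* h) refl 512ℚ 2ℚ L (½ ^ℚ n)) ⟩
        δ′ + 512ℚ * (2ℚ * L) * ½ ^ℚ n                 ≤⟨ +-mono-≤ (p⊓q≤p (½ * δ) 1ℚ) (small n N₂≤n) ⟩
        ½ * δ + ½ * δ                                ≡⟨ solve 1 (λ d → con ½ :* d :+ con ½ :* d := d) refl δ ⟩
        δ                                            ∎
    where
    open ≤-Reasoning
    -- Capped at 1, so that |P n|² ≤ δ′ · 1.
    δ′ = ½ * δ ⊓ 1ℚ
    L  = 512ℚ * 2ℚ
    ∣1∣≤ : ∀ k → ∣ 1ℚ ∣ ≤ 2ℚ ^ℚ k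
    ∣1∣≤ zero    = ≤-refl
    ∣1∣≤ (suc k) = ≤-trans (∣1∣≤ k) (≤-from-difference (solve 1 (λ p → con 2ℚ :* p :- p := p) refl (2ℚ ^ℚ k))
      (^-nonNeg (nonNegative⁻¹ 2ℚ) k))

  -- The terms with k ≤ 8 sum to less than -0.138, and the others to at most 28 / 2⁸ < 0.110.
  cosSeries-3/2-nonPos : ∀ {w} → (∀ k → ∣ w k ∣ ≤ 2ℚ ^ℚ k) → w 0 ≡ 1ℚ →
    2ℚ ≤ w 2 → w 4 ≤ 6ℚ → 20ℚ ≤ w 6 → ∀ n → 9 ℕ.≤ n → cosSeries w (+ 3 / 2) n ≤ 0ℚ
  cosSeries-3/2-nonPos {w} ∣w∣≤ w0≡1 2≤w2 w4≤6 20≤w6 = partialSum-nonPos {M = 28ℚ} (nonNegative⁻¹ 28ℚ)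
    (λ k 9≤k → ≤-trans (∣∣-*-mono {cosCoeff T k} {w k} (∣cosCoeff∣-bound {T} ≤-refl k) (∣w∣≤ k))
      (≤-trans (≤-reflexive (trans (solve 3 (λ a f b → a :* f :* b := a :* b :* f) refl (T ^ℚ k) (1/! k) (2ℚ ^ℚ k))
                                   (cong (_* 1/! k) (sym (^-distrib-* T 2ℚ k)))))
        (exp-bound {M = 28ℚ} 9 (nonNegative⁻¹ 3ℚ) 0≤½ (≤ᵇ⇒≤ _) (≤ᵇ⇒≤ _) k 9≤k)))
    (+-mono-≤ (+-mono-≤ (+-mono-≤ (+-mono-≤ (+-mono-≤ (+-mono-≤ (+-mono-≤ (+-mono-≤ (+-mono-≤ (≤-refl {0ℚ})
      (≤-reflexive (cong (cosCoeff T 0 *_) w0≡1)))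
      (≤-reflexive (*-zeroˡ (w 1))))
      (*-monoˡ-≤-nonPos (cosCoeff T 2) 2≤w2))
      (≤-reflexive (*-zeroˡ (w 3))))
      (*-monoˡ-≤-nonNeg (cosCoeff T 4) w4≤6))
      (≤-reflexive (*-zeroˡ (w 5))))
      (*-monoˡ-≤-nonPos (cosCoeff T 6) 20≤w6))
      (≤-reflexive (*-zeroˡ (w 7))))
      (*-monoˡ-≤-nonNeg (cosCoeff T 8) (≤-trans (p≤∣p∣ (w 8)) (∣w∣≤ 8))))
    (≤ᵇ⇒≤ _)
    where
    T    = + 3 / 2
    28ℚ = + 28 / 1

open RationalSeries

-- Counting walks on a cycle

module Walks where

  open import Defs using (SimpleGraph; cycle; Next)
  open import Data.Rational.Base
  open import Data.Rational.Properties

  indicator : ∀ {A : Set} → Dec A → ℚ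
  indicator d = if does d then 1ℚ else 0ℚ

  indicator-yes : ∀ {A : Set} (d : Dec A) → A → indicator d ≡ 1ℚ
  indicator-yes (yes _) _ = refl
  indicator-yes (no ¬a) a = contradiction a ¬a

  indicator-no : ∀ {A : Set} (d : Dec A) → ¬ A → indicator d ≡ 0ℚ
  indicator-no (yes a) ¬a = contradiction a ¬a
  indicator-no (no _)  _  = refl

  0≤indicator : ∀ {A : Set} (d : Dec A) → 0ℚ ≤ indicator d
  0≤indicator (yes _) = nonNegative⁻¹ 1ℚ
  0≤indicator (no _)  = ≤-refl

  indicator≤1 : ∀ {A : Set} (d : Dec A) → indicator d ≤ 1ℚ
  indicator≤1 (yes _) = ≤-refl
  indicator≤1 (no _)  = nonNegative⁻¹ 1ℚ

  indicator-cong : ∀ {A B : Set} (a : Dec A) (b : Dec B) → (A → B) → (B → A) → indicator a ≡ indicator b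
  indicator-cong (yes x) b A→B B→A = sym (indicator-yes b (A→B x))
  indicator-cong (no ¬x) b A→B B→A = sym (indicator-no b (¬x ∘ B→A))

  indicator-⊎ : ∀ {A B C : Set} (a : Dec A) (b : Dec B) (c : Dec C) →
    (A → B ⊎ C) → (B → A) → (C → A) → (B → ¬ C) → indicator a ≡ indicator b + indicator c
  indicator-⊎ (yes x) (yes y) c       to fromB fromC excl = cong (_+_ 1ℚ) (sym (indicator-no c (excl y)))
  indicator-⊎ (yes x) (no ¬y) (yes z) to fromB fromC excl = refl
  indicator-⊎ (yes x) (no ¬y) (no ¬z) to fromB fromC excl with to x
  ... | inj₁ y = contradiction y ¬y
  ... | inj₂ z = contradiction z ¬z
  indicator-⊎ (no ¬x) b       c       to fromB fromC excl =
    sym (cong₂ _+_ (indicator-no b (¬x ∘ fromB)) (indicator-no c (¬x ∘ fromC)))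

  sum-indicator-* : ∀ {n} (i : Fin n) (g : Fin n → ℚ) → sum (λ j → indicator (i Fin.≟ j) * g j) ≡ g i
  sum-indicator-* {suc n} zero    g = trans
    (cong₂ _+_ (*-identityˡ (g zero))
      (trans (sum-cong-≗ (λ j → *-zeroˡ (g (suc j)))) (sum-replicate-zero n)))
    (+-identityʳ (g zero))
  sum-indicator-* {suc n} (suc i) g = trans
    (cong₂ _+_ (*-zeroˡ (g zero)) (sum-indicator-* i (λ j → g (suc j))))
    (+-identityˡ (g (suc i)))

  walks : ∀ {n} → SimpleGraph n → ℕ → Fin n → Fin n → ℚ
  walks G zero    u w = indicator (u Fin.≟ w)
  walks G (suc k) u w = sum (λ v → indicator (SimpleGraph._~?_ G u v) * walks G k v w)

  Next-functional : ∀ {n} {u v w : Fin n} → Next u v → Next u w → v ≡ w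
  Next-functional             (inj₁ e)       (inj₁ e′)       = Fin.toℕ-injective (trans (sym e) e′)
  Next-functional {v = v}     (inj₁ e)       (inj₂ (e′ , _)) = contradiction (trans (sym e) e′) (ℕ.<⇒≢ (Fin.toℕ<n v))
  Next-functional {w = w}     (inj₂ (e , _)) (inj₁ e′)       = contradiction (trans (sym e′) e) (ℕ.<⇒≢ (Fin.toℕ<n w))
  Next-functional             (inj₂ (_ , e)) (inj₂ (_ , e′)) = Fin.toℕ-injective (trans e (sym e′))

  Next-injective : ∀ {n} {u v w : Fin n} → Next u w → Next v w → u ≡ v
  Next-injective (inj₁ e)       (inj₁ e′)       = Fin.toℕ-injective (ℕ.suc-injective (trans e (sym e′)))
  Next-injective (inj₁ e)       (inj₂ (_ , e′)) = contradiction (trans e e′) ℕ.1+n≢0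
  Next-injective (inj₂ (_ , e)) (inj₁ e′)       = contradiction (trans e′ e) ℕ.1+n≢0
  Next-injective (inj₂ (e , _)) (inj₂ (e′ , _)) = Fin.toℕ-injective (ℕ.suc-injective (trans e (sym e′)))

  -- With at least three vertices the successor and the predecessor of a vertex are distinct, so the
  -- sum over neighbours has two separate terms.
  Next-asym : ∀ {n} → 3 ℕ.≤ n → {u v : Fin n} → Next u v → ¬ Next v u
  Next-asym 3≤n {u} {v} (inj₁ e) (inj₁ e′) = ℕ.<-irrefl (sym (trans (cong suc e) e′)) (ℕ.m<n⇒m<1+n (ℕ.n<1+n (toℕ u)))
  Next-asym 3≤n {u} {v} (inj₁ e) (inj₂ (e′ , u≡0)) =
    contradiction (subst (3 ℕ.≤_) (trans (sym e′) (cong suc (trans (sym e) (cong suc u≡0)))) 3≤n) λ { (ℕ.s≤s (ℕ.s≤s ())) }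
  Next-asym 3≤n {u} {v} (inj₂ (e , v≡0)) (inj₁ e′) =
    contradiction (subst (3 ℕ.≤_) (trans (sym e) (cong suc (trans (sym e′) (cong suc v≡0)))) 3≤n) λ { (ℕ.s≤s (ℕ.s≤s ())) }
  Next-asym 3≤n {u} {v} (inj₂ (e , v≡0)) (inj₂ (e′ , u≡0)) =
    contradiction (subst (3 ℕ.≤_) (trans (sym e) (cong suc u≡0)) 3≤n) λ { (ℕ.s≤s ()) }

  module CycleWalks (n′ : ℕ) (3≤n : 3 ℕ.≤ suc n′) where

    n : ℕ
    n = suc n′

    C : SimpleGraph n
    C = cycle n 3≤n

    -- Naming vertices by arbitrary naturals modulo n gives `vertex (suc x)` the neighbours
    -- `vertex x` and `vertex (suc (suc x))`, with neither wraparound cases nor subtraction.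
    vertex : ℕ → Fin n
    vertex x = fromℕ< (m%n<n x n)

    toℕ-vertex : ∀ x → toℕ (vertex x) ≡ x % n
    toℕ-vertex x = Fin.toℕ-fromℕ< (m%n<n x n)

    suc-% : ∀ x → suc x % n ≡ suc (x % n) % n
    suc-% x = trans (cong (λ y → suc y % n) (m≡m%n+[m/n]*n x n)) ([m+kn]%n≡m%n (suc (x % n)) (x ℕ./ n) n)

    next-vertex : ∀ x → Next (vertex x) (vertex (suc x))
    next-vertex x with ℕ.m≤n⇒m<n∨m≡n (m%n<n x n)
    ... | inj₁ 1+r<n = inj₁ (trans (cong suc (toℕ-vertex x))
      (sym (trans (toℕ-vertex (suc x)) (trans (suc-% x) (m<n⇒m%n≡m 1+r<n)))))
    ... | inj₂ 1+r≡n = inj₂ (trans (cong suc (toℕ-vertex x)) 1+r≡n ,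
      trans (toℕ-vertex (suc x)) (trans (suc-% x) (trans (cong (_% n) 1+r≡n) (n%n≡0 n))))

    vertex-+-multiple : ∀ u {e} → n ∣ e → vertex (toℕ u ℕ.+ e) ≡ u
    vertex-+-multiple u (divides q refl) = Fin.toℕ-injective
      (trans (toℕ-vertex (toℕ u ℕ.+ q ℕ.* n)) (trans ([m+kn]%n≡m%n (toℕ u) q n) (m<n⇒m%n≡m (Fin.toℕ<n u))))

    vertex-+-multiple⁻¹ : ∀ u e → vertex (toℕ u ℕ.+ e) ≡ u → n ∣ e
    vertex-+-multiple⁻¹ u e eq = divides ((toℕ u ℕ.+ e) ℕ./ n) (ℕ.+-cancelˡ-≡ (toℕ u) e _
      (trans (m≡m%n+[m/n]*n (toℕ u ℕ.+ e) n)
        (cong (ℕ._+ (toℕ u ℕ.+ e) ℕ./ n ℕ.* n) (trans (sym (toℕ-vertex (toℕ u ℕ.+ e))) (cong toℕ eq)))))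

    walks-suc : ∀ k x w → walks C (suc k) (vertex (suc x)) w ≡ walks C k (vertex x) w + walks C k (vertex (suc (suc x))) w
    walks-suc k x w = begin
      sum (λ v → indicator (v₁ ~? v) * f v)
        ≡⟨ sum-cong-≗ (λ v → trans (cong (_* f v) (split v)) (*-distribʳ-+ (f v) (indicator (v₀ Fin.≟ v)) (indicator (v₂ Fin.≟ v)))) ⟩
      sum (λ v → indicator (v₀ Fin.≟ v) * f v + indicator (v₂ Fin.≟ v) * f v)
        ≡⟨ ∑-distrib-+ (λ v → indicator (v₀ Fin.≟ v) * f v) (λ v → indicator (v₂ Fin.≟ v) * f v) ⟩
      sum (λ v → indicator (v₀ Fin.≟ v) * f v) + sum (λ v → indicator (v₂ Fin.≟ v) * f v)
        ≡⟨ cong₂ _+_ (sum-indicator-* v₀ f) (sum-indicator-* v₂ f) ⟩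
      f v₀ + f v₂ ∎
      where
      open ≡-Reasoning
      open SimpleGraph C using (_~_; _~?_)
      v₀ = vertex x
      v₁ = vertex (suc x)
      v₂ = vertex (suc (suc x))
      f : Fin n → ℚ
      f v = walks C k v w
      neighbour : ∀ {v} → v₁ ~ v → v₀ ≡ v ⊎ v₂ ≡ v
      neighbour (inj₁ next) = inj₂ (Next-functional (next-vertex (suc x)) next)
      neighbour (inj₂ prev) = inj₁ (Next-injective (next-vertex x) prev)
      v₀≢v₂ : v₀ ≢ v₂
      v₀≢v₂ e = Next-asym 3≤n (next-vertex x) (subst (Next v₁) (sym e) (next-vertex (suc x)))
      split : ∀ v → indicator (v₁ ~? v) ≡ indicator (v₀ Fin.≟ v) + indicator (v₂ Fin.≟ v)
      split v = indicator-⊎ (v₁ ~? v) (v₀ Fin.≟ v) (v₂ Fin.≟ v) neighbour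
        (λ { refl → inj₂ (next-vertex x) }) (λ { refl → inj₁ (next-vertex (suc x)) })
        (λ e e′ → v₀≢v₂ (trans e (sym e′)))

    -- Presents v as a successor, v + (n - 1) + 1, so that `walks-suc` applies to every vertex.
    vertex-surjective : ∀ v → vertex (suc (toℕ v ℕ.+ n′)) ≡ v
    vertex-surjective v = trans (cong vertex (sym (ℕ.+-suc (toℕ v) n′))) (vertex-+-multiple v ∣-refl)

    walks-neighbours : ∀ k v w → walks C (suc k) v w ≡
      walks C k (vertex (toℕ v ℕ.+ n′)) w + walks C k (vertex (suc (suc (toℕ v ℕ.+ n′)))) w
    walks-neighbours k v w = trans (cong (λ v → walks C (suc k) v w) (sym (vertex-surjective v)))
      (walks-suc k (toℕ v ℕ.+ n′) w)

    walks-nonNeg : ∀ k v w → 0ℚ ≤ walks C k v w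
    walks-nonNeg zero    v w = 0≤indicator (v Fin.≟ w)
    walks-nonNeg (suc k) v w = subst (0ℚ ≤_) (sym (walks-neighbours k v w))
      (+-nonNeg (walks-nonNeg k _ w) (walks-nonNeg k _ w))

    walks-bound : ∀ k v w → walks C k v w ≤ 2ℚ ^ℚ k
    walks-bound zero    v w = indicator≤1 (v Fin.≟ w)
    walks-bound (suc k) v w = subst₂ _≤_ (sym (walks-neighbours k v w))
      (solve 1 (λ p → p :+ p := con 2ℚ :* p) refl (2ℚ ^ℚ k))
      (+-mono-≤ (walks-bound k _ w) (walks-bound k _ w))

    ∣walks∣-bound : ∀ k v w → ∣ walks C k v w ∣ ≤ 2ℚ ^ℚ k
    ∣walks∣-bound k v w = subst (_≤ 2ℚ ^ℚ k) (sym (0≤p⇒∣p∣≡p (walks-nonNeg k v w))) (walks-bound k v w)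

    -- Closed walks through Pascal's rule modulo n

    module ClosedWalks (u : Fin n) where

      -- Walks of length k from u + k + e to u; letting the start move with k avoids subtraction in walksFrom-suc.
      walksFrom : ℕ → ℕ → ℚ
      walksFrom k e = walks C k (vertex (k ℕ.+ (toℕ u ℕ.+ e))) u

      closedWalks : ℕ → ℚ
      closedWalks k = walks C k u u

      -- Pascal's rule: relative to a start that moves with k, a step backwards keeps the offset e
      -- and a step forwards raises it by 2.
      walksFrom-suc : ∀ k e → walksFrom (suc k) e ≡ walksFrom k e + walksFrom k (2 ℕ.+ e)
      walksFrom-suc k e = trans (walks-suc k (k ℕ.+ (toℕ u ℕ.+ e)) u)
        (cong (λ x → walksFrom k e + walks C k (vertex x) u) (sym (begin
          k ℕ.+ (toℕ u ℕ.+ (2 ℕ.+ e))      ≡⟨ cong (k ℕ.+_) (ℕ.+-comm (toℕ u) (2 ℕ.+ e)) ⟩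
          k ℕ.+ (2 ℕ.+ (e ℕ.+ toℕ u))      ≡⟨ ℕ.+-comm k (2 ℕ.+ (e ℕ.+ toℕ u)) ⟩
          2 ℕ.+ ((e ℕ.+ toℕ u) ℕ.+ k)      ≡⟨ cong (2 ℕ.+_) (ℕ.+-comm (e ℕ.+ toℕ u) k) ⟩
          2 ℕ.+ (k ℕ.+ (e ℕ.+ toℕ u))      ≡⟨ cong (λ x → 2 ℕ.+ (k ℕ.+ x)) (ℕ.+-comm e (toℕ u)) ⟩
          2 ℕ.+ (k ℕ.+ (toℕ u ℕ.+ e))      ∎)))
        where open ≡-Reasoning

      walksFrom-0≡1 : ∀ {e} → n ∣ e → walksFrom 0 e ≡ 1ℚ
      walksFrom-0≡1 {e} n∣e = indicator-yes (vertex (toℕ u ℕ.+ e) Fin.≟ u) (vertex-+-multiple u n∣e)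

      walksFrom-0≡0 : ∀ {e} → n ∤ e → walksFrom 0 e ≡ 0ℚ
      walksFrom-0≡0 {e} n∤e = indicator-no (vertex (toℕ u ℕ.+ e) Fin.≟ u) (n∤e ∘ vertex-+-multiple⁻¹ u e)

      -- A closed walk has offset -k modulo n, and (n - 1)k is a natural number with this residue.
      closedWalks≡ : ∀ k → closedWalks k ≡ walksFrom k (n′ ℕ.* k)
      closedWalks≡ k = cong (λ v → walks C k v u) (sym (trans (cong vertex shift) (vertex-+-multiple u (m∣m*n k))))
        where
        shift : k ℕ.+ (toℕ u ℕ.+ n′ ℕ.* k) ≡ toℕ u ℕ.+ n ℕ.* k
        shift = trans (sym (ℕ.+-assoc k (toℕ u) (n′ ℕ.* k)))
          (trans (cong (ℕ._+ n′ ℕ.* k) (ℕ.+-comm k (toℕ u))) (ℕ.+-assoc (toℕ u) k (n′ ℕ.* k)))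

      closedWalks-0 : closedWalks 0 ≡ 1ℚ
      closedWalks-0 = indicator-yes (u Fin.≟ u) refl

      module _ (2∣n : 2 ∣ n) where

        -- Pascal's rule changes e by 0 or 2, so an odd offset stays odd down to length 0, where
        -- only multiples of the even number n count.
        walksFrom-odd : ∀ k {e} → 2 ∤ e → walksFrom k e ≡ 0ℚ
        walksFrom-odd zero        2∤e = walksFrom-0≡0 (λ n∣e → 2∤e (∣-trans 2∣n n∣e))
        walksFrom-odd (suc k) {e} 2∤e = trans (walksFrom-suc k e)
          (cong₂ _+_ (walksFrom-odd k 2∤e) (walksFrom-odd k (λ 2∣2+e → 2∤e (∣m+n∣m⇒∣n 2∣2+e ∣-refl))))

        closedWalks-odd : ∀ k → 2 ∤ k → closedWalks k ≡ 0ℚ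
        closedWalks-odd k 2∤k = trans (closedWalks≡ k) (walksFrom-odd k (λ 2∣n′k → 2∤k
          (∣m+n∣m⇒∣n (subst (2 ∣_) (ℕ.+-comm k (n′ ℕ.* k)) (∣-trans 2∣n (m∣m*n k))) 2∣n′k)))

      -- A row of Pascal's triangle; rows 4 and 6 follow, two steps at a time. For closed walks the
      -- middle offset k + e equals nk, and its binomial coefficient counts the walks that do not
      -- wind around the cycle.
      walksFrom-2 : ∀ e → walksFrom 2 e ≡ walksFrom 0 e + 2ℚ * walksFrom 0 (2 ℕ.+ e) + walksFrom 0 (4 ℕ.+ e)
      walksFrom-2 e = trans (trans (walksFrom-suc 1 e) (cong₂ _+_ (walksFrom-suc 0 e) (walksFrom-suc 0 (2 ℕ.+ e))))
        (solve 3 (λ a b c → (a :+ b) :+ (b :+ c) := a :+ con 2ℚ :* b :+ c) refl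
          (walksFrom 0 e) (walksFrom 0 (2 ℕ.+ e)) (walksFrom 0 (4 ℕ.+ e)))

      walksFrom-4 : ∀ e → walksFrom 4 e ≡
        walksFrom 0 e + 4ℚ * walksFrom 0 (2 ℕ.+ e) + 6ℚ * walksFrom 0 (4 ℕ.+ e) + 4ℚ * walksFrom 0 (6 ℕ.+ e) + walksFrom 0 (8 ℕ.+ e)
      walksFrom-4 e = trans
        (trans (walksFrom-suc 3 e) (cong₂ _+_ (trans (walksFrom-suc 2 e) (cong₂ _+_ (walksFrom-2 e) (walksFrom-2 (2 ℕ.+ e))))
                                              (trans (walksFrom-suc 2 (2 ℕ.+ e)) (cong₂ _+_ (walksFrom-2 (2 ℕ.+ e)) (walksFrom-2 (4 ℕ.+ e))))))
        (solve 5 (λ a b c d e → ((a :+ con 2ℚ :* b :+ c) :+ (b :+ con 2ℚ :* c :+ d)) :+ ((b :+ con 2ℚ :* c :+ d) :+ (c :+ con 2ℚ :* d :+ e))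
                    := a :+ con 4ℚ :* b :+ con 6ℚ :* c :+ con 4ℚ :* d :+ e) refl
          (walksFrom 0 e) (walksFrom 0 (2 ℕ.+ e)) (walksFrom 0 (4 ℕ.+ e)) (walksFrom 0 (6 ℕ.+ e)) (walksFrom 0 (8 ℕ.+ e)))

      walksFrom-6 : ∀ e → walksFrom 6 e ≡ 20ℚ * walksFrom 0 (6 ℕ.+ e) +
        (walksFrom 0 e + 6ℚ * walksFrom 0 (2 ℕ.+ e) + 15ℚ * walksFrom 0 (4 ℕ.+ e)
         + 15ℚ * walksFrom 0 (8 ℕ.+ e) + 6ℚ * walksFrom 0 (10 ℕ.+ e) + walksFrom 0 (12 ℕ.+ e))
      walksFrom-6 e = trans
        (trans (walksFrom-suc 5 e) (cong₂ _+_ (trans (walksFrom-suc 4 e) (cong₂ _+_ (walksFrom-4 e) (walksFrom-4 (2 ℕ.+ e))))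
                                              (trans (walksFrom-suc 4 (2 ℕ.+ e)) (cong₂ _+_ (walksFrom-4 (2 ℕ.+ e)) (walksFrom-4 (4 ℕ.+ e))))))
        (solve 7 (λ a b c d e f g →
          ((a :+ con 4ℚ :* b :+ con 6ℚ :* c :+ con 4ℚ :* d :+ e) :+ (b :+ con 4ℚ :* c :+ con 6ℚ :* d :+ con 4ℚ :* e :+ f)) :+
          ((b :+ con 4ℚ :* c :+ con 6ℚ :* d :+ con 4ℚ :* e :+ f) :+ (c :+ con 4ℚ :* d :+ con 6ℚ :* e :+ con 4ℚ :* f :+ g))
          := con 20ℚ :* d :+ (a :+ con 6ℚ :* b :+ con 15ℚ :* c :+ con 15ℚ :* e :+ con 6ℚ :* f :+ g)) refl
          (walksFrom 0 e) (walksFrom 0 (2 ℕ.+ e)) (walksFrom 0 (4 ℕ.+ e)) (walksFrom 0 (6 ℕ.+ e))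
          (walksFrom 0 (8 ℕ.+ e)) (walksFrom 0 (10 ℕ.+ e)) (walksFrom 0 (12 ℕ.+ e)))

      walksFrom-nonNeg : ∀ k e → 0ℚ ≤ walksFrom k e
      walksFrom-nonNeg k e = walks-nonNeg k _ u

      2≤closedWalks-2 : 2ℚ ≤ closedWalks 2
      2≤closedWalks-2 = ≤-from-difference {r = walksFrom 0 e + walksFrom 0 (4 ℕ.+ e)}
        (trans (cong (_- 2ℚ) (trans (closedWalks≡ 2) (trans (walksFrom-2 e)
            (cong (λ p → walksFrom 0 e + 2ℚ * p + walksFrom 0 (4 ℕ.+ e)) (walksFrom-0≡1 (m∣m*n 2))))))
          (solve 2 (λ a b → a :+ con 2ℚ :* con 1ℚ :+ b :- con 2ℚ := a :+ b) refl (walksFrom 0 e) (walksFrom 0 (4 ℕ.+ e))))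
        (+-nonNeg (walksFrom-nonNeg 0 e) (walksFrom-nonNeg 0 (4 ℕ.+ e)))
        where e = n′ ℕ.* 2

      20≤closedWalks-6 : 20ℚ ≤ closedWalks 6
      20≤closedWalks-6 = ≤-from-difference
        (trans (cong (_- 20ℚ) (trans (closedWalks≡ 6) (trans (walksFrom-6 e)
            (cong (λ p → 20ℚ * p + rest) (walksFrom-0≡1 (m∣m*n 6))))))
          (solve 1 (λ r → con 20ℚ :* con 1ℚ :+ r :- con 20ℚ := r) refl rest))
        (+-nonNeg (+-nonNeg (+-nonNeg (+-nonNeg (+-nonNeg
          (walksFrom-nonNeg 0 e)
          (*-nonNeg (nonNegative⁻¹ 6ℚ) (walksFrom-nonNeg 0 (2 ℕ.+ e))))
          (*-nonNeg (nonNegative⁻¹ 15ℚ) (walksFrom-nonNeg 0 (4 ℕ.+ e))))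
          (*-nonNeg (nonNegative⁻¹ 15ℚ) (walksFrom-nonNeg 0 (8 ℕ.+ e))))
          (*-nonNeg (nonNegative⁻¹ 6ℚ) (walksFrom-nonNeg 0 (10 ℕ.+ e))))
          (walksFrom-nonNeg 0 (12 ℕ.+ e)))
        where
        e    = n′ ℕ.* 6
        rest = walksFrom 0 e + 6ℚ * walksFrom 0 (2 ℕ.+ e) + 15ℚ * walksFrom 0 (4 ℕ.+ e)
             + 15ℚ * walksFrom 0 (8 ℕ.+ e) + 6ℚ * walksFrom 0 (10 ℕ.+ e) + walksFrom 0 (12 ℕ.+ e)

      -- The middle offset is 4n. The others differ from it by 2 or 4, so none is a multiple of n ≥
      -- 5 and only the binomial coefficient 6 survives. For n = 4 the two outer ones would count as
      -- well and give 8.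
      closedWalks-4≤6 : 5 ℕ.≤ n → closedWalks 4 ≤ 6ℚ
      closedWalks-4≤6 5≤n = ≤-reflexive (trans (closedWalks≡ 4) (trans (walksFrom-4 e) (begin
        walksFrom 0 e + 4ℚ * walksFrom 0 (2 ℕ.+ e) + 6ℚ * walksFrom 0 (4 ℕ.+ e) + 4ℚ * walksFrom 0 (6 ℕ.+ e) + walksFrom 0 (8 ℕ.+ e)
          ≡⟨ cong₂ (λ p q → p + 4ℚ * q + 6ℚ * walksFrom 0 (4 ℕ.+ e) + 4ℚ * walksFrom 0 (6 ℕ.+ e) + walksFrom 0 (8 ℕ.+ e))
               (walksFrom-0≡0 (λ n∣e → n∤ 4≤4 (∣m+n∣m⇒∣n (subst (n ∣_) (ℕ.+-comm 4 e) n∣4+e) n∣e)))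
               (walksFrom-0≡0 (λ n∣2+e → n∤ 2≤4 (∣m+n∣m⇒∣n (subst (n ∣_) (ℕ.+-comm 2 (2 ℕ.+ e)) n∣4+e) n∣2+e))) ⟩
        0ℚ + 4ℚ * 0ℚ + 6ℚ * walksFrom 0 (4 ℕ.+ e) + 4ℚ * walksFrom 0 (6 ℕ.+ e) + walksFrom 0 (8 ℕ.+ e)
          ≡⟨ cong₂ (λ p q → 0ℚ + 4ℚ * 0ℚ + 6ℚ * walksFrom 0 (4 ℕ.+ e) + 4ℚ * p + q)
               (walksFrom-0≡0 (λ n∣6+e → n∤ 2≤4 (∣m+n∣m⇒∣n (subst (n ∣_) (ℕ.+-comm 2 (4 ℕ.+ e)) n∣6+e) n∣4+e)))
               (walksFrom-0≡0 (λ n∣8+e → n∤ 4≤4 (∣m+n∣m⇒∣n (subst (n ∣_) (ℕ.+-comm 4 (4 ℕ.+ e)) n∣8+e) n∣4+e))) ⟩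
        0ℚ + 4ℚ * 0ℚ + 6ℚ * walksFrom 0 (4 ℕ.+ e) + 4ℚ * 0ℚ + 0ℚ
          ≡⟨ cong (λ p → 0ℚ + 4ℚ * 0ℚ + 6ℚ * p + 4ℚ * 0ℚ + 0ℚ) (walksFrom-0≡1 n∣4+e) ⟩
        6ℚ ∎)))
        where
        open ≡-Reasoning
        e = n′ ℕ.* 4
        n∣4+e : n ∣ 4 ℕ.+ e
        n∣4+e = m∣m*n 4
        2≤4 : 2 ℕ.≤ 4
        2≤4 = ℕ.s≤s (ℕ.s≤s ℕ.z≤n)
        4≤4 : 4 ℕ.≤ 4
        4≤4 = ℕ.≤-refl
        n∤ : ∀ {m} → suc m ℕ.≤ 4 → n ∤ suc m
        n∤ 1+m≤4 n∣1+m = ℕ.<⇒≱ 5≤n (ℕ.≤-trans (∣⇒≤ n∣1+m) 1+m≤4)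

  open CycleWalks
  open ClosedWalks

  rePow-odd : ∀ t k → 2 ∤ k → rePow t k ≡ 0ℚ
  rePow-odd t zero          2∤0 = contradiction (2 ∣0) 2∤0
  rePow-odd t (suc zero)    _   = solve 1 (λ t → :- (t :* con 0ℚ) := con 0ℚ) refl t
  rePow-odd t (suc (suc k)) 2∤k = trans (cong (λ p → - (t * (t * p))) (rePow-odd t k (λ 2∣k → 2∤k (∣m∣n⇒∣m+n ∣-refl 2∣k))))
    (solve 1 (λ t → :- (t :* (t :* con 0ℚ)) := con 0ℚ) refl t)

  -- Walk counts of the four-cycle

  module FourCycle (3≤4 : 3 ℕ.≤ 4) (u : Fin 4) where

    from : ℕ → ℕ → ℚ
    from = walksFrom 3 3≤4 u

    closed : ℕ → ℚ
    closed = closedWalks 3 3≤4 u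

    from-0-periodic : ∀ e → from 0 (4 ℕ.+ e) ≡ from 0 e
    from-0-periodic e = indicator-cong (vertex 3 3≤4 (toℕ u ℕ.+ (4 ℕ.+ e)) Fin.≟ u) (vertex 3 3≤4 (toℕ u ℕ.+ e) Fin.≟ u)
      (λ eq → vertex-+-multiple 3 3≤4 u (∣m+n∣m⇒∣n (vertex-+-multiple⁻¹ 3 3≤4 u (4 ℕ.+ e) eq) ∣-refl))
      (λ eq → vertex-+-multiple 3 3≤4 u (∣m∣n⇒∣m+n ∣-refl (vertex-+-multiple⁻¹ 3 3≤4 u e eq)))

    -- At length 0 the period is 4. After one step the count is a sum over e and e + 2, and a shift
    -- by 2 merely swaps these two summands.
    from-suc-periodic : ∀ k e → from (suc k) (2 ℕ.+ e) ≡ from (suc k) e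
    from-suc-periodic zero    e = trans (walksFrom-suc 3 3≤4 u 0 (2 ℕ.+ e))
      (trans (cong (_+_ (from 0 (2 ℕ.+ e))) (from-0-periodic e))
        (trans (+-comm (from 0 (2 ℕ.+ e)) (from 0 e)) (sym (walksFrom-suc 3 3≤4 u 0 e))))
    from-suc-periodic (suc k) e = trans (walksFrom-suc 3 3≤4 u (suc k) (2 ℕ.+ e))
      (trans (cong₂ _+_ (from-suc-periodic k e) (from-suc-periodic k (2 ℕ.+ e)))
        (sym (walksFrom-suc 3 3≤4 u (suc k) e)))

    from-1-even : ∀ {e} → 2 ∣ e → from 1 e ≡ 1ℚ
    from-1-even (divides q refl) = go q
      where
      go : ∀ q → from 1 (q ℕ.* 2) ≡ 1ℚ
      go zero    = trans (walksFrom-suc 3 3≤4 u 0 0)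
        (cong₂ _+_ (walksFrom-0≡1 3 3≤4 u (4 ∣0)) (walksFrom-0≡0 3 3≤4 u {2} (λ 4∣2 → ℕ.<⇒≱ (ℕ.s≤s (ℕ.s≤s (ℕ.s≤s ℕ.z≤n))) (∣⇒≤ 4∣2))))
      go (suc q) = trans (from-suc-periodic 0 (q ℕ.* 2)) (go q)

    -- By the period 2, both summands of Pascal's rule agree from length 1 on, so each further step
    -- doubles the count.
    from-suc : ∀ k {e} → 2 ∣ e → from (suc k) e ≡ 2ℚ ^ℚ k
    from-suc zero        2∣e = from-1-even 2∣e
    from-suc (suc k) {e} 2∣e = trans (walksFrom-suc 3 3≤4 u (suc k) e)
      (trans (cong₂ _+_ (from-suc k 2∣e) (trans (from-suc-periodic k e) (from-suc k 2∣e)))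
        (solve 1 (λ p → p :+ p := con 2ℚ :* p) refl (2ℚ ^ℚ k)))

    closed-even : ∀ k → 2 ∣ suc k → closed (suc k) ≡ 2ℚ ^ℚ k
    closed-even k 2∣k = trans (closedWalks≡ 3 3≤4 u (suc k)) (from-suc k (∣-trans 2∣k (n∣m*n 3)))

    -- For even k > 0 the count ½ · 2ᵏ is the factor that turns a coefficient of cos t into one of ½
    -- cos 2t. For odd k both sides vanish, because (it)ᵏ is imaginary.
    closed-cos² : ∀ t k → cosCoeff t k * closed k ≡ conv (cosCoeff t) (cosCoeff t) k
    closed-cos² t zero    = cong (1ℚ *_) (closedWalks-0 3 3≤4 u)
    closed-cos² t (suc k) = trans (go (2 ∣? suc k)) (sym (DoubleAngle.cos-cos (double-angle t (suc k))))
      where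
      c = cosCoeff t (suc k)
      go : Dec (2 ∣ suc k) → c * closed (suc k) ≡ ½ * (2ℚ * 2ℚ ^ℚ k) * c + 0ℚ
      go (yes 2∣k) = trans (cong (c *_) (closed-even k 2∣k))
        (solve 2 (λ c p → c :* p := con ½ :* (con 2ℚ :* p) :* c :+ con 0ℚ) refl c (2ℚ ^ℚ k))
      go (no 2∤k)  = trans (cong (_* closed (suc k)) c≡0)
        (trans (solve 2 (λ w p → con 0ℚ :* w := con ½ :* (con 2ℚ :* p) :* con 0ℚ :+ con 0ℚ) refl (closed (suc k)) (2ℚ ^ℚ k))
          (cong (λ c → ½ * (2ℚ * 2ℚ ^ℚ k) * c + 0ℚ) (sym c≡0)))
        where
        c≡0 : c ≡ 0ℚ
        c≡0 = trans (cong (_* 1/! (suc k)) (rePow-odd t (suc k) 2∤k)) (*-zeroˡ (1/! (suc k)))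

open import Defs
open import Data.Nat.Properties using (<⇒≤)
open import Data.Rational.Base using (ℚ; 0ℚ; 1ℚ; ½)
open Walks
open CycleWalks
open ClosedWalks

-- From rational series to the matrix exponential

sumᶜ : ∀ {n} → (Fin n → ℂ) → ℂ
sumᶜ = Algebra.Definitions.RawMonoid.sum +ᶜ-rawMonoid

seq-re-sum : ∀ {n} (f : Fin n → ℂ) m → seq (re (sumᶜ f)) m ≡ sum (λ i → seq (re (f i)) m)
seq-re-sum {zero}  f m = refl
seq-re-sum {suc n} f m = cong (seq (re (f zero)) m ℚ.+_) (seq-re-sum (λ i → f (suc i)) m)

seq-im-sum : ∀ {n} (f : Fin n → ℂ) m → seq (im (sumᶜ f)) m ≡ sum (λ i → seq (im (f i)) m)
seq-im-sum {zero}  f m = refl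
seq-im-sum {suc n} f m = cong (seq (im (f zero)) m ℚ.+_) (seq-im-sum (λ i → f (suc i)) m)

seq-re-if : ∀ {A : Set} (d : Dec A) m → seq (re (if does d then 1ᶜ else 0ᶜ)) m ≡ indicator d
seq-re-if (yes _) m = refl
seq-re-if (no _)  m = refl

seq-im-if : ∀ {A : Set} (d : Dec A) m → seq (im (if does d then 1ᶜ else 0ᶜ)) m ≡ 0ℚ
seq-im-if (yes _) m = refl
seq-im-if (no _)  m = refl

module Exponential {n} (G : SimpleGraph n) (t : ℚ) where

  open SimpleGraph G using (_~?_)

  itA : Matrix n
  itA = (0ℝ +i fromℚ t) • adjacency G

  seq-re-itA-* : ∀ u v z m → seq (re (itA u v *ᶜ z)) m ≡ ℚ.- (t ℚ.* seq (im z) m) ℚ.* indicator (u ~? v)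
  seq-re-itA-* u v z m = trans
    (cong₂ (λ a b → (0ℚ ℚ.* a ℚ.- t ℚ.* b) ℚ.* x ℚ.- (0ℚ ℚ.* b ℚ.+ t ℚ.* a) ℚ.* y) (seq-re-if (u ~? v) m) (seq-im-if (u ~? v) m))
    (solve 4 (λ t a x y → (con 0ℚ :* a :- t :* con 0ℚ) :* x :- (con 0ℚ :* con 0ℚ :+ t :* a) :* y := (:- (t :* y)) :* a) refl
      t (indicator (u ~? v)) x y)
    where
    x = seq (re z) m
    y = seq (im z) m

  seq-im-itA-* : ∀ u v z m → seq (im (itA u v *ᶜ z)) m ≡ t ℚ.* seq (re z) m ℚ.* indicator (u ~? v)
  seq-im-itA-* u v z m = trans
    (cong₂ (λ a b → (0ℚ ℚ.* a ℚ.- t ℚ.* b) ℚ.* y ℚ.+ (0ℚ ℚ.* b ℚ.+ t ℚ.* a) ℚ.* x) (seq-re-if (u ~? v) m) (seq-im-if (u ~? v) m))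
    (solve 4 (λ t a x y → (con 0ℚ :* a :- t :* con 0ℚ) :* y :+ (con 0ℚ :* con 0ℚ :+ t :* a) :* x := t :* x :* a) refl
      t (indicator (u ~? v)) x y)
    where
    x = seq (re z) m
    y = seq (im z) m

  -- An entry of (itA)ᵏ is (it)ᵏ times a number of walks. Multiplication by it exchanges real and
  -- imaginary parts, hence the mutual induction. The right sides do not depend on m, since t is
  -- rational.
  seq-re-power : ∀ k u w m → seq (re ((itA ^ k) u w)) m ≡ rePow t k ℚ.* walks G k u w
  seq-im-power : ∀ k u w m → seq (im ((itA ^ k) u w)) m ≡ imPow t k ℚ.* walks G k u w
  seq-re-power zero    u w m = trans (seq-re-if (u Fin.≟ w) m) (sym (ℚ.*-identityˡ (indicator (u Fin.≟ w))))
  seq-re-power (suc k) u w m = begin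
    seq (re (sumᶜ (λ v → itA u v *ᶜ (itA ^ k) v w))) m
      ≡⟨ seq-re-sum (λ v → itA u v *ᶜ (itA ^ k) v w) m ⟩
    sum (λ v → seq (re (itA u v *ᶜ (itA ^ k) v w)) m)
      ≡⟨ sum-cong-≗ (λ v → trans (seq-re-itA-* u v ((itA ^ k) v w) m)
           (trans (cong (λ y → ℚ.- (t ℚ.* y) ℚ.* a v) (seq-im-power k v w m))
             (solve 4 (λ t i w a → (:- (t :* (i :* w))) :* a := (:- (t :* i)) :* (a :* w)) refl t (imPow t k) (walks G k v w) (a v)))) ⟩
    sum (λ v → ℚ.- (t ℚ.* imPow t k) ℚ.* (a v ℚ.* walks G k v w))
      ≡⟨ *-distribˡ-sum (ℚ.- (t ℚ.* imPow t k)) (λ v → a v ℚ.* walks G k v w) ⟨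
    ℚ.- (t ℚ.* imPow t k) ℚ.* sum (λ v → a v ℚ.* walks G k v w) ∎
    where
    open ≡-Reasoning
    a : Fin n → ℚ
    a v = indicator (u ~? v)
  seq-im-power zero    u w m = trans (seq-im-if (u Fin.≟ w) m) (sym (ℚ.*-zeroˡ (indicator (u Fin.≟ w))))
  seq-im-power (suc k) u w m = begin
    seq (im (sumᶜ (λ v → itA u v *ᶜ (itA ^ k) v w))) m
      ≡⟨ seq-im-sum (λ v → itA u v *ᶜ (itA ^ k) v w) m ⟩
    sum (λ v → seq (im (itA u v *ᶜ (itA ^ k) v w)) m)
      ≡⟨ sum-cong-≗ (λ v → trans (seq-im-itA-* u v ((itA ^ k) v w) m)
           (trans (cong (λ x → t ℚ.* x ℚ.* a v) (seq-re-power k v w m))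
             (solve 4 (λ t r w a → t :* (r :* w) :* a := t :* r :* (a :* w)) refl t (rePow t k) (walks G k v w) (a v)))) ⟩
    sum (λ v → t ℚ.* rePow t k ℚ.* (a v ℚ.* walks G k v w))
      ≡⟨ *-distribˡ-sum (t ℚ.* rePow t k) (λ v → a v ℚ.* walks G k v w) ⟨
    t ℚ.* rePow t k ℚ.* sum (λ v → a v ℚ.* walks G k v w) ∎
    where
    open ≡-Reasoning
    a : Fin n → ℚ
    a v = indicator (u ~? v)

  reSeries imSeries : Fin n → Fin n → ℕ → ℚ
  reSeries u w = cosSeries (λ k → walks G k u w) t
  imSeries u w = partialSum (λ k → sinCoeff t k ℚ.* walks G k u w)

  seq-re-expSum : ∀ u w N m → seq (re (expSum itA N u w)) m ≡ reSeries u w N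
  seq-re-expSum u w zero    m = refl
  seq-re-expSum u w (suc N) m = cong₂ ℚ._+_ (seq-re-expSum u w N m) (trans
    (cong₂ (λ x y → 1/! N ℚ.* x ℚ.- 0ℚ ℚ.* y) (seq-re-power N u w m) (seq-im-power N u w m))
    (solve 4 (λ f r i w → f :* (r :* w) :- con 0ℚ :* (i :* w) := r :* f :* w) refl (1/! N) (rePow t N) (imPow t N) (walks G N u w)))

  seq-im-expSum : ∀ u w N m → seq (im (expSum itA N u w)) m ≡ imSeries u w N
  seq-im-expSum u w zero    m = refl
  seq-im-expSum u w (suc N) m = cong₂ ℚ._+_ (seq-im-expSum u w N m) (trans
    (cong₂ (λ x y → 1/! N ℚ.* y ℚ.+ 0ℚ ℚ.* x) (seq-re-power N u w m) (seq-im-power N u w m))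
    (solve 4 (λ f r i w → f :* (i :* w) :+ con 0ℚ :* (r :* w) := i :* f :* w) refl (1/! N) (rePow t N) (imPow t N) (walks G N u w)))

½*-< : ∀ {p} → 0ℚ ℚ.< p → ½ ℚ.* p ℚ.< p
½*-< {p} 0<p = subst (½ ℚ.* p ℚ.<_) (ℚ.*-identityˡ p) (ℚ.*-monoˡ-<-pos p {{ℚ.positive 0<p}} {½} {1ℚ} ½<1)
  where
  ½<1 : ½ ℚ.< 1ℚ
  ½<1 = ℚ.≰⇒> λ { (ℚ.*≤* (ℤ.+≤+ (s≤s ()))) }

tail⇒cauchy : ∀ f → (∀ {m n} → m ≤ℕ n → ℚ.∣ f n ℚ.- f m ∣ ℚ.≤ 512ℚ ℚ.* (2ℚ ℚ.* ½ ^ℚ m)) → IsCauchy f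
tail⇒cauchy f tail ε 0<ε =
  let K , small = tail-eventually-small (½*-pos 0<ε)
      close : ∀ {m n} → K ≤ℕ m → m ≤ℕ n → ℚ.∣ f n ℚ.- f m ∣ ℚ.< ε
      close = λ {m} K≤m m≤n → ℚ.≤-<-trans (ℚ.≤-trans (tail m≤n) (small m K≤m)) (½*-< 0<ε)
  in K , λ m n K≤m K≤n → go close m n K≤m K≤n (ℕ.≤-total m n)
  where
  go : ∀ {K} → (∀ {m n} → K ≤ℕ m → m ≤ℕ n → ℚ.∣ f n ℚ.- f m ∣ ℚ.< ε) →
       ∀ m n → K ≤ℕ m → K ≤ℕ n → m ≤ℕ n ⊎ n ≤ℕ m → ℚ.∣ f m ℚ.- f n ∣ ℚ.< ε
  go close m n K≤m K≤n (inj₁ m≤n) = subst (ℚ._< ε) (∣p-q∣≡∣q-p∣ (f n) (f m)) (close K≤m m≤n)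
  go close m n K≤m K≤n (inj₂ n≤m) = close K≤n n≤m

-- Each s N is a constant sequence with the value of the N-th approximation of x. So s N - x at
-- index m is a difference of two approximations of x, and convergence is the Cauchy property of x
-- itself.
converges-diagonally : ∀ {s x} → (∀ N m → seq (s N) m ≡ seq x N) → ConvergesTo s x
converges-diagonally {s} {x} s≡x ε (δ , 0<δ , M , δ<ε) =
  let K , close = isCauchy x (½ ℚ.* δ) (½*-pos 0<δ)
  in K , λ N K≤N → ½ ℚ.* δ , ½*-pos 0<δ , M ℕ.⊔ K , λ m M⊔K≤m → begin-strict
    ℚ.∣ seq (s N) m ℚ.- seq x m ∣ ℚ.+ ½ ℚ.* δ        ≡⟨ cong (λ p → ℚ.∣ p ℚ.- seq x m ∣ ℚ.+ ½ ℚ.* δ) (s≡x N m) ⟩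
    ℚ.∣ seq x N ℚ.- seq x m ∣ ℚ.+ ½ ℚ.* δ            <⟨ ℚ.+-monoˡ-< (½ ℚ.* δ) (close N m K≤N (ℕ.m⊔n≤o⇒n≤o M K M⊔K≤m)) ⟩
    ½ ℚ.* δ ℚ.+ ½ ℚ.* δ                              ≡⟨ solve 1 (λ d → con ½ :* d :+ con ½ :* d := con 0ℚ :+ d) refl δ ⟩
    0ℚ ℚ.+ δ                                         <⟨ δ<ε m (ℕ.m⊔n≤o⇒m≤o M K M⊔K≤m) ⟩
    seq ε m                                          ∎
  where open ℚ.≤-Reasoning

transition-matrix : ∀ {n} (G : SimpleGraph n) → (∀ k v w → ℚ.∣ walks G k v w ∣ ℚ.≤ 2ℚ ^ℚ k) → ∀ t → ℚ.∣ t ∣ ℚ.≤ 2ℚ → Matrix n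
transition-matrix G ∣walks∣≤ t ∣t∣≤2 u w =
  mkℝ (Exponential.reSeries G t u w) (tail⇒cauchy (Exponential.reSeries G t u w) (weighted-tail (∣cosCoeff∣-bound ∣t∣≤2) (λ k → ∣walks∣≤ k u w))) +i
  mkℝ (Exponential.imSeries G t u w) (tail⇒cauchy (Exponential.imSeries G t u w) (weighted-tail (∣sinCoeff∣-bound ∣t∣≤2) (λ k → ∣walks∣≤ k u w)))

isTransitionMatrix : ∀ {n} (G : SimpleGraph n) ∣walks∣≤ t ∣t∣≤2 →
  IsTransitionMatrix G (fromℚ t) (transition-matrix G ∣walks∣≤ t ∣t∣≤2)
isTransitionMatrix G ∣walks∣≤ t ∣t∣≤2 u w =
  converges-diagonally {λ N → re (expSum (Exponential.itA G t) N u w)} {re (transition-matrix G ∣walks∣≤ t ∣t∣≤2 u w)} (Exponential.seq-re-expSum G t u w) ,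
  converges-diagonally {λ N → im (expSum (Exponential.itA G t) N u w)} {im (transition-matrix G ∣walks∣≤ t ∣t∣≤2 u w)} (Exponential.seq-im-expSum G t u w)

-- Return moduli and the conclusion

∣p∣*∣p∣≡p*p : ∀ p → ℚ.∣ p ∣ ℚ.* ℚ.∣ p ∣ ≡ p ℚ.* p
∣p∣*∣p∣≡p*p p = go (ℚ.∣p∣≡p∨∣p∣≡-p p)
  where
  go : ℚ.∣ p ∣ ≡ p ⊎ ℚ.∣ p ∣ ≡ ℚ.- p → ℚ.∣ p ∣ ℚ.* ℚ.∣ p ∣ ≡ p ℚ.* p
  go (inj₁ e) = cong₂ ℚ._*_ e e
  go (inj₂ e) = trans (cong₂ ℚ._*_ e e) (solve 1 (λ p → (:- p) :* (:- p) := p :* p) refl p)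

∣re∣-isModulus : ∀ z → (∀ n → seq (im z) n ≡ 0ℚ) → IsModulus z ∣ re z ∣
∣re∣-isModulus z im≡0 =
  (λ ε 0<ε → 0 , λ n _ → ℚ.+-mono-≤-< (ℚ.0≤∣p∣ (seq (re z) n)) 0<ε) ,
  (λ ε 0<ε → 0 , λ n _ → subst (ℚ._< ε) (cong ℚ.∣_∣ (sym (difference n))) 0<ε)
  where
  difference : ∀ n → let x = seq (re z) n ; y = seq (im z) n in
    ℚ.∣ x ∣ ℚ.* ℚ.∣ x ∣ ℚ.- (x ℚ.* x ℚ.+ y ℚ.* y) ≡ 0ℚ
  difference n = trans (cong₂ (λ p y → p ℚ.- (x ℚ.* x ℚ.+ y ℚ.* y)) (∣p∣*∣p∣≡p*p x) (im≡0 n))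
    (solve 1 (λ x → x :* x :- (x :* x :+ con 0ℚ :* con 0ℚ) := con 0ℚ) refl x)
    where x = seq (re z) n

imPow-even : ∀ t k → 2 ∣ k → imPow t k ≡ 0ℚ
imPow-even t zero          _   = refl
imPow-even t (suc zero)    2∣1 = contradiction (∣⇒≤ 2∣1) λ { (s≤s ()) }
imPow-even t (suc (suc k)) 2∣k = trans (cong (λ p → t ℚ.* ℚ.- (t ℚ.* p)) (imPow-even t k (∣m+n∣m⇒∣n 2∣k ∣-refl)))
  (solve 1 (λ t → t :* (:- (t :* con 0ℚ)) := con 0ℚ) refl t)

partialSum-0 : ∀ {x} → (∀ k → x k ≡ 0ℚ) → ∀ n → partialSum x n ≡ 0ℚ
partialSum-0 x≡0 zero    = refl
partialSum-0 x≡0 (suc n) = cong₂ ℚ._+_ (partialSum-0 x≡0 n) (x≡0 n)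

-- Even powers of it are real, and odd ones are multiplied by a vanishing number of closed walks; so
-- |U(t)ᵤᵤ| is just the absolute value of the real part.
imSeries-0 : ∀ {n} (G : SimpleGraph n) t u → (∀ k → 2 ∤ k → walks G k u u ≡ 0ℚ) →
  ∀ N → Exponential.imSeries G t u u N ≡ 0ℚ
imSeries-0 G t u odd = partialSum-0 λ k → go k (2 ∣? k)
  where
  go : ∀ k → Dec (2 ∣ k) → sinCoeff t k ℚ.* walks G k u u ≡ 0ℚ
  go k (yes 2∣k) = trans (cong (λ p → p ℚ.* 1/! k ℚ.* walks G k u u) (imPow-even t k 2∣k))
    (solve 2 (λ f w → con 0ℚ :* f :* w := con 0ℚ) refl (1/! k) (walks G k u u))
  go k (no 2∤k)  = trans (cong (sinCoeff t k ℚ.*_) (odd k 2∤k)) (ℚ.*-zeroʳ (sinCoeff t k))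

notSedentary-of-roots : ∀ {n} (G : SimpleGraph n) u → (∀ k v w → ℚ.∣ walks G k v w ∣ ℚ.≤ 2ℚ ^ℚ k) →
  (∀ k → 2 ∤ k → walks G k u u ≡ 0ℚ) →
  (∀ δ → 0ℚ ℚ.< δ → ∃[ t ] (0ℚ ℚ.< t × t ℚ.≤ 2ℚ × ∃[ N ] (∀ n → N ≤ℕ n → ℚ.∣ cosSeries (λ k → walks G k u u) t n ∣ ℚ.≤ δ))) →
  NotSedentary G u
notSedentary-of-roots G u ∣walks∣≤ odd roots =
  (λ { r (_ , _ , _ , _ , 0≤r , _) → 0≤r }) ,
  (λ { ε (δ , 0<δ , M , δ<ε) →
    let t , 0<t , t≤2 , N , small = roots (½ ℚ.* δ) (½*-pos 0<δ)
        ∣t∣≤2 = ∣∣≤-of-0<≤ 0<t t≤2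
        U     = transition-matrix G ∣walks∣≤ t ∣t∣≤2
    in ∣ re (U u u) ∣ ,
       (fromℚ t , (½ ℚ.* t , ½*-pos 0<t , 0 , λ _ _ → subst (ℚ._< t) (sym (ℚ.+-identityˡ (½ ℚ.* t))) (½*-< 0<t)) ,
        U , isTransitionMatrix G ∣walks∣≤ t ∣t∣≤2 , ∣re∣-isModulus (U u u) (imSeries-0 G t u odd)) ,
       -- Strict inequality of reals needs a uniform gap: one half of δ bounds |f(t)|, the other
       -- half is the gap.
       ½ ℚ.* δ , ½*-pos 0<δ , M ℕ.⊔ N , λ n M⊔N≤n → begin-strict
         ℚ.∣ seq (re (U u u)) n ∣ ℚ.+ ½ ℚ.* δ     ≤⟨ ℚ.+-monoˡ-≤ (½ ℚ.* δ) (small n (ℕ.m⊔n≤o⇒n≤o M N M⊔N≤n)) ⟩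
         ½ ℚ.* δ ℚ.+ ½ ℚ.* δ                      ≡⟨ solve 1 (λ d → con ½ :* d :+ con ½ :* d := con 0ℚ :+ d) refl δ ⟩
         0ℚ ℚ.+ δ                                 <⟨ δ<ε n (ℕ.m⊔n≤o⇒m≤o M N M⊔N≤n) ⟩
         seq ε n                                  ≡⟨ ℚ.+-identityˡ (seq ε n) ⟨
         0ℚ ℚ.+ seq ε n                           ∎ })
  where open ℚ.≤-Reasoning

theorem44 : ∀ (n : ℕ) (4≤n : 4 ≤ℕ n) → 2 ∣ n → (u : Fin n) →
    NotSedentary (cycle n (<⇒≤ 4≤n)) u
theorem44 (suc n′) 4≤n 2∣n u = notSedentary-of-roots (cycle (suc n′) (<⇒≤ 4≤n)) u
  (∣walks∣-bound n′ (<⇒≤ 4≤n)) (closedWalks-odd n′ (<⇒≤ 4≤n) u 2∣n) (roots n′ 4≤n u (ℕ.m≤n⇒m<n∨m≡n 4≤n))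
  where
  roots : ∀ n′ (4≤n : 4 ≤ℕ suc n′) u → 4 ℕ.< suc n′ ⊎ 4 ≡ suc n′ → ∀ δ → 0ℚ ℚ.< δ →
    ∃[ t ] (0ℚ ℚ.< t × t ℚ.≤ 2ℚ × ∃[ N ] (∀ n → N ≤ℕ n → ℚ.∣ cosSeries (closedWalks n′ (<⇒≤ 4≤n) u) t n ∣ ℚ.≤ δ))
  roots n′ 4≤n u (inj₂ refl) = cos²Series-root (FourCycle.closed-cos² (<⇒≤ 4≤n) u)
  roots n′ 4≤n u (inj₁ 5≤n)  = cosSeries-root {T = + 3 ℚ./ 2} ∣w∣≤ w0≡1 (ℚ.positive⁻¹ (+ 3 ℚ./ 2)) (ℚ.≤ᵇ⇒≤ _) 9
    (cosSeries-3/2-nonPos ∣w∣≤ w0≡1 (2≤closedWalks-2 n′ (<⇒≤ 4≤n) u) (closedWalks-4≤6 n′ (<⇒≤ 4≤n) u 5≤n) (20≤closedWalks-6 n′ (<⇒≤ 4≤n) u))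
    where
    ∣w∣≤ = λ k → ∣walks∣-bound n′ (<⇒≤ 4≤n) k u u
    w0≡1 = closedWalks-0 n′ (<⇒≤ 4≤n) u
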